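{- Let $Z_n$ be the number of zeros of a random lattice path $P_n$ of length $n$ (chosen according to the model in the context). Let $r\ge1$ be an integer. For positive integers $n$ with $n\ge 2r-2$, \begin{align*} \mathbb{P}(Z_n=r)&=\frac{2^r}{n+1}\,\frac{\binom{\lceil n/2\rceil}{r}}{\binom nr}\left(\frac{2\lceil n/2\rceil}{r(r+1)}+\frac{r-1}{r+1}+[n\text{ even}]\,\frac1r\right)\\ &\quad+[n\text{ even}]\,\frac{2^{r-1}(r-1)}{(n+1)r}\,\frac{\binom{n/2}{r-1}}{\binom nr}. \end{align*} Moreover, $\mathbb{P}(Z_0=r)=[r=1]$ for all integers $r\ge 0$. In all other cases (that is, $n\ge1$ and either $n<2r-2$ or $r=0$), $\mathbb{P}(Z_n=r)=0$.
   Context: $[\mathit{expr}]$ is $1$ if $\mathit{expr}$ is true and $0$ otherwise; a term multiplied by a bracket equal to $0$ is taken to be $0$. Random path model: for an integer $n\ge0$, a random path $P_n$ on the lattice $\mathbb{Z}^2$ with steps $(1,+1)$ and $(1,-1)$, ending in $(n,0)$, is chosen as follows. First choose a starting point $(0,S)$ with $S$ uniformly distributed in $\{ -n,-n+2,\dots,n-2,n\}$. Then choose a path uniformly at random among all paths from $(0,S)$ to $(n,0)$. A zero of $P_n$ is a lattice point $(x,0)\in P_n$ visited by the path (including the starting point if $S=0$ and the end point $(n,0)$). -}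

module Defs where

open import Data.Bool using (if_then_else_)
open import Data.Integer as ℤ using (ℤ; +_; 0ℤ; 1ℤ; -1ℤ)
open import Data.List using (List; []; _∷_; _++_; map; filter; foldr; concatMap; length; upTo)
open import Data.Nat using (ℕ; zero; suc; _*_; _+_; _∸_; _≤_; _≥_; _≟_; NonZero; z≤n; s≤s; >-nonZero)
open import Data.Nat.Combinatorics using (_C_; nCk+nC[k+1]≡[n+1]C[k+1])
open import Data.Nat.Properties using (≤-trans; ≤-reflexive; m≤m+n; m≤n+m; +-identityʳ; +-suc; m*n≢0)
open import Data.Product using (_×_; _,_)
open import Data.Rational as ℚ using (ℚ; 0ℚ; 1ℚ)
open import Data.Vec as Vec using (Vec; []; _∷_)
open import Level using (Level)
open import Relation.Binary.PropositionalEquality using (_≡_; sym)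
open import Relation.Nullary using (Dec; does)
open import Relation.Unary using (Pred; Decidable)

private
  variable
    a p : Level
    A B : Set a

-- Iverson bracket, [expr] ∈ {0, 1}.
⟦_⟧ : {P : Set p} → Dec P → ℚ
⟦ P? ⟧ = if does P? then 1ℚ else 0ℚ

-- A finitely supported distribution is a list of weighted outcomes; weights
-- are nonnegative and sum to 1 in all uses.
Dist : Set a → Set a
Dist A = List (A × ℚ)

-- The entries of the list are meant to be distinct.  There is no uniform
-- distribution on the empty list; the value there is a dummy.
uniform : List A → Dist A
uniform []          = []
uniform xs@(_ ∷ _) = map (λ x → x , + 1 ℚ./ length xs) xs

infixl 1 _>>=_

_>>=_ : Dist A → (A → Dist B) → Dist B
d >>= k = concatMap (λ (x , w) → map (λ (y , v) → y , w ℚ.* v) (k x)) d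

Prob : {P : Pred A p} → Decidable P → Dist A → ℚ
Prob P? d = foldr (λ (x , w) acc → ⟦ P? x ⟧ ℚ.* w ℚ.+ acc) 0ℚ d

data Step : Set where
  ↗ ↘ : Step

Δ : Step → ℤ
Δ ↗ = 1ℤ
Δ ↘ = -1ℤ

-- A path of length n starting at the lattice point (0 , start).
record Path (n : ℕ) : Set where
  constructor path
  field
    start : ℤ
    steps : Vec Step n

open Path public

-- The path visits exactly one lattice point (x , y) for each x = 0, …, n;
-- its second coordinate y is the entry of index x.
heightsFrom : ∀ {n} → ℤ → Vec Step n → Vec ℤ (suc n)
heightsFrom y []       = y ∷ []
heightsFrom y (d ∷ ds) = y ∷ heightsFrom (y ℤ.+ Δ d) ds

heights : ∀ {n} → Path n → Vec ℤ (suc n)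
heights P = heightsFrom (start P) (steps P)

endHeight : ∀ {n} → Path n → ℤ
endHeight P = Vec.last (heights P)

zeros : ∀ {n} → Path n → ℕ
zeros P = Vec.count (ℤ._≟ 0ℤ) (heights P)

allSteps : ∀ n → List (Vec Step n)
allSteps zero    = [] ∷ []
allSteps (suc n) = map (↗ ∷_) (allSteps n) ++ map (↘ ∷_) (allSteps n)

pathsFrom : ∀ n → ℤ → List (Path n)
pathsFrom n s = filter (λ P → endHeight P ℤ.≟ 0ℤ) (map (path s) (allSteps n))

-- -n, -n+2, …, n-2, n
startHeights : ℕ → List ℤ
startHeights n = map (λ k → + (2 * k) ℤ.- + n) (upTo (suc n))

-- Both uniform choices are from nonempty lists: (n , 0) is reached from
-- (0 , 2k - n) by the paths with k down-steps and n - k up-steps.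
randomPath : ∀ n → Dist (Path n)
randomPath n = uniform (startHeights n) >>= λ s → uniform (pathsFrom n s)

ℙ[Z_≡_] : ℕ → ℕ → ℚ
ℙ[Z n ≡ r ] = Prob (λ P → zeros P ≟ r) (randomPath n)

instance
  m*[1+n]≢0 : ∀ {m n} → .{{NonZero m}} → NonZero (m * suc n)
  m*[1+n]≢0 {m} {n} = m*n≢0 m (suc n)

nCk≥1 : ∀ n k → k ≤ n → n C k ≥ 1
nCk≥1 n       zero    _         = s≤s z≤n
nCk≥1 (suc n) (suc k) (s≤s k≤n) =
  ≤-trans (nCk≥1 n k k≤n)
    (≤-trans (m≤m+n _ _) (≤-reflexive (nCk+nC[k+1]≡[n+1]C[k+1] n k)))

r≤n : ∀ n r → n ≥ 1 → n ≥ 2 * r ∸ 2 → r ≤ n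
r≤n n zero          _   _ = z≤n
r≤n n (suc zero)    n≥1 _ = n≥1
r≤n n (suc (suc r)) _   h = ≤-trans (≤-trans (s≤s (m≤n+m _ r)) (≤-reflexive eq)) h
  where
  eq : suc (r + suc r) ≡ r + suc (suc (r + 0))
  eq rewrite +-identityʳ r = sym (+-suc r (suc r))

nCr≢0 : ∀ n r → n ≥ 1 → n ≥ 2 * r ∸ 2 → NonZero (n C r)
nCr≢0 n r n≥1 h = >-nonZero (nCk≥1 n r (r≤n n r n≥1 h))

{-# OPTIONS --safe #-}

-- A first-step recurrence shows that the number of paths with u up-steps and d ≥ u down-steps, ending
-- at height 0 and having r zeros, is 2 ^ (r − 1) times the ballot number
-- (u + d − r) C (d − 1) − (u + d − r) C d; by reflection the same count holds with u and d exchanged.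
-- Dividing by n C u, where n = u + d, the trinomial identities turn this into
-- 2 ^ (r − 1) / (r (n C r)) times (n − u) (u C (r − 1)) − r (u C r), whose sum over u < m is
-- (n − r + 1) (m C r) − 2 r (m C (r + 1)).  The starting heights are split into two halves, the
-- second containing the start at height 0 when n is even, and reflected onto each other.
module Submission where

-- The ballot number has a direct meaning. Take a start at height d - u ≥ 0. Reflect upwards each of
-- the r - 1 excursions between consecutive zeros, which accounts for the power of 2, and delete the
-- first up-step of each. What remains is a path with u - r + 1 up-steps and d down-steps that
-- reaches the level -(r - 1) for the first time with its last step. Dropping this last step, a
-- down-step, gives the upper index u + d - r and the lower index d - 1. Dividing by n C u is
-- conditioning on the start. This denominator varies with the start; the trinomial identities trade
-- it for the fixed n C r, and only then does the average over all starts become a sum of binomial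
-- coefficients with fixed lower indices. Truncated subtraction is avoided throughout the integer
-- part: a difference of counts appears as a sum moved to the other side, and real subtraction
-- starts only in ℚ. There `suc ρ` stands for r, so that r - 1 is `ρ`.

module PathCounts where

  open import Data.Nat
  open import Data.Nat.Properties
  open import Data.Nat.Combinatorics using (_C_; nCk+nC[k+1]≡[n+1]C[k+1]; nCk≡nC[n∸k]; k>n⇒nCk≡0; nCn≡1; nC1≡n)
  open import Data.Nat.Tactic.RingSolver using (solve-∀)
  open import Data.Product using (_,_)
  open import Relation.Binary.PropositionalEquality using (_≡_; refl; sym; trans; cong; cong₂; subst; module ≡-Reasoning)
  open import Relation.Nullary using (yes; no)
  open ≡-Reasoning

  -- Binomial coefficients: Pascal's rule, symmetry, factorials.

  pascal : ∀ n k → suc n C suc k ≡ n C k + n C suc k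
  pascal n k = sym (nCk+nC[k+1]≡[n+1]C[k+1] n k)

  [m+n]Cm≡[m+n]Cn : ∀ m n → (m + n) C m ≡ (m + n) C n
  [m+n]Cm≡[m+n]Cn m n = trans (nCk≡nC[n∸k] (m≤m+n m n)) (cong ((m + n) C_) (m+n∸m≡n m n))

  [m+n]Cm*m!*n!≡[m+n]! : ∀ m n → ((m + n) C m) * (m ! * n !) ≡ (m + n) !
  [m+n]Cm*m!*n!≡[m+n]! zero    n       = trans (*-identityˡ (1 * n !)) (*-identityˡ (n !))
  [m+n]Cm*m!*n!≡[m+n]! (suc m) zero    rewrite +-identityʳ m | nCn≡1 (suc m) = trans (*-identityˡ (suc m ! * 1)) (*-identityʳ (suc m !))
  [m+n]Cm*m!*n!≡[m+n]! (suc m) (suc n) = begin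
    (suc (m + suc n) C suc m) * (suc m ! * suc n !)
      ≡⟨ cong (_* (suc m ! * suc n !)) (pascal (m + suc n) m) ⟩
    ((m + suc n) C m + (m + suc n) C suc m) * (suc m * m ! * suc n !)
      ≡⟨ lemma ((m + suc n) C m) ((m + suc n) C suc m) (suc m) (m !) (suc n) (n !) ⟩
    suc m * (((m + suc n) C m) * (m ! * suc n !)) + suc n * (((m + suc n) C suc m) * (suc m ! * n !))
      ≡⟨ cong₂ (λ x y → suc m * x + suc n * y) ([m+n]Cm*m!*n!≡[m+n]! m (suc n)) ih ⟩
    suc m * (m + suc n) ! + suc n * (m + suc n) !
      ≡⟨ *-distribʳ-+ ((m + suc n) !) (suc m) (suc n) ⟨
    suc (m + suc n) ! ∎
    where
    lemma : ∀ x y a b c d → (x + y) * (a * b * (c * d)) ≡ a * (x * (b * (c * d))) + c * (y * (a * b * d))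
    lemma = solve-∀
    ih : ((m + suc n) C suc m) * (suc m ! * n !) ≡ (m + suc n) !
    ih rewrite +-suc m n = [m+n]Cm*m!*n!≡[m+n]! (suc m) n

  -- Paths to height 0 with a given number of zeros.

  -- visits n a r is the number of paths of length n from height a or − a to height 0 with r zeros.
  visits : ℕ → ℕ → ℕ → ℕ
  visits zero    zero    1       = 1
  visits zero    _       _       = 0
  visits (suc n) zero    zero    = 0
  visits (suc n) zero    (suc r) = 2 * visits n 1 r
  visits (suc n) (suc a) r       = visits n (suc (suc a)) r + visits n a r

  visits-0 : ∀ n a → visits n a 0 ≡ 0
  visits-0 zero    zero    = refl
  visits-0 zero    (suc a) = refl
  visits-0 (suc n) zero    = refl
  visits-0 (suc n) (suc a) = cong₂ _+_ (visits-0 n (suc (suc a))) (visits-0 n a)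

  -- Reaching height 0 takes `a` steps and each of the r - 1 excursions between consecutive zeros
  -- takes at least two, so r ≥ 1 zeros require n ≥ a + 2 (r - 1).
  n+2<a+2r⇒visits≡0 : ∀ n a r → n + 2 < a + 2 * r → visits n a r ≡ 0
  n+2<a+2r⇒visits≡0 zero    zero    zero          _ = refl
  n+2<a+2r⇒visits≡0 zero    zero    (suc zero)    (s≤s (s≤s ()))
  n+2<a+2r⇒visits≡0 zero    zero    (suc (suc r)) _ = refl
  n+2<a+2r⇒visits≡0 zero    (suc a) r             _ = refl
  n+2<a+2r⇒visits≡0 (suc n) zero    zero          _ = refl
  n+2<a+2r⇒visits≡0 (suc n) zero    (suc r)       h =
    cong (2 *_) (n+2<a+2r⇒visits≡0 n 1 r (s≤s⁻¹ (subst (suc n + 2 <_) (eq r) h)))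
    where
    eq : ∀ r → 2 * suc r ≡ suc (1 + 2 * r)
    eq = solve-∀
  n+2<a+2r⇒visits≡0 (suc n) (suc a) r             h =
    cong₂ _+_ (n+2<a+2r⇒visits≡0 n (suc (suc a)) r (m≤n⇒m≤1+n (<⇒≤ h)))
              (n+2<a+2r⇒visits≡0 n a r (s≤s⁻¹ h))

  -- Here ρ + t and suc q are the numbers of up- and down-steps of a path of length n from height a:
  -- the count is 2 ^ ρ times the ballot number (t + q) C q − (t + q) C suc q.  Both satisfy the same
  -- first-step recurrence, the factor 2 arising each time the path leaves height 0.
  visits-ballot : ∀ n t ρ q a → n ≡ t + ρ + suc q → suc q ≡ t + ρ + a →
    visits n a (suc ρ) + 2 ^ ρ * ((t + q) C suc q) ≡ 2 ^ ρ * ((t + q) C q)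
  visits-ballot zero t ρ q a n≡ _ with () ← trans n≡ (+-suc (t + ρ) q)
  visits-ballot (suc n) t zero q zero n≡ q≡
    rewrite +-identityʳ t | +-identityʳ t | sym q≡ | visits-0 n 1
    -- A nonempty path from 0 to 0 has at least two zeros, so the count is 0; here `t` is `suc q`,
    -- and the two binomials agree by symmetry.
    = cong (_+ 0) ([m+n]Cm≡[m+n]Cn (suc q) q)
  visits-ballot (suc n) t (suc ρ) q zero n≡ q≡ = begin
    2 * visits n 1 (suc ρ) + 2 * 2 ^ ρ * ((t + q) C suc q)
      ≡⟨ lemma (visits n 1 (suc ρ)) (2 ^ ρ) ((t + q) C suc q) ⟩
    2 * (visits n 1 (suc ρ) + 2 ^ ρ * ((t + q) C suc q))
      -- After reflection the step away from 0 is an up-step. It uses up one zero and one up-step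
      -- together, so `t` and `q` stay the same.
      ≡⟨ cong (2 *_) (visits-ballot n t ρ q 1
           (suc-injective (trans n≡ (cong (_+ suc q) (+-suc t ρ)))) (trans q≡ (lemma′ t ρ))) ⟩
    2 * (2 ^ ρ * ((t + q) C q))
      ≡⟨ *-assoc 2 (2 ^ ρ) _ ⟨
    2 ^ suc ρ * ((t + q) C q) ∎
    where
    lemma : ∀ v p c → 2 * v + 2 * p * c ≡ 2 * (v + p * c)
    lemma = solve-∀
    lemma′ : ∀ t ρ → t + suc ρ + 0 ≡ t + ρ + 1
    lemma′ = solve-∀
  visits-ballot (suc n) zero zero zero (suc a) n≡ q≡
    with refl ← n≡ | refl ← q≡ = refl
  -- A single down-step from a positive height leaves room only for `t`, `ρ` and `a` all zero, the
  -- case settled just before.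
  visits-ballot (suc n) zero (suc ρ) zero (suc a) n≡ q≡
    with () ← trans (suc-injective q≡) (+-suc ρ a)
  visits-ballot (suc n) (suc t) ρ zero (suc a) n≡ q≡
    with () ← trans (suc-injective q≡) (+-suc (t + ρ) a)
  visits-ballot (suc n) zero ρ (suc q) (suc a) n≡ q≡ = begin
    visits n (suc (suc a)) (suc ρ) + visits n a (suc ρ) + 2 ^ ρ * (suc q C suc (suc q))
      -- With `t` zero, all `ρ` up-steps are needed for the excursions between zeros, so the first
      -- step from a positive height must go down.
      ≡⟨ cong₂ (λ x y → x + visits n a (suc ρ) + 2 ^ ρ * y) (n+2<a+2r⇒visits≡0 n (2 + a) (suc ρ) n+2<)
           (trans (k>n⇒nCk≡0 (n<1+n (suc q))) (sym (k>n⇒nCk≡0 (n<1+n q)))) ⟩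
    visits n a (suc ρ) + 2 ^ ρ * (q C suc q)
      ≡⟨ visits-ballot n zero ρ q a (suc-injective (trans n≡ (+-suc ρ (suc q))))
           (suc-injective (trans q≡ (+-suc ρ a))) ⟩
    2 ^ ρ * (q C q)
      ≡⟨ cong (2 ^ ρ *_) (trans (nCn≡1 q) (sym (nCn≡1 (suc q)))) ⟩
    2 ^ ρ * (suc q C suc q) ∎
    where
    lemma : ∀ ρ a → ρ + (ρ + suc a) + 2 ≡ suc (a + 2 * suc ρ)
    lemma = solve-∀
    n+2< : n + 2 < suc (suc a) + 2 * suc ρ
    n+2< = m≤n⇒m≤1+n (≤-reflexive (trans (cong (_+ 2) (trans n≡ (cong (ρ +_) q≡))) (lemma ρ a)))
  visits-ballot (suc n) (suc t) ρ (suc q) (suc a) n≡ q≡ = begin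
    v₁ + v₂ + p * (suc s C suc (suc q))
      ≡⟨ cong (λ x → v₁ + v₂ + p * x) (pascal s (suc q)) ⟩
    v₁ + v₂ + p * (s C suc q + s C suc (suc q))
      ≡⟨ lemma v₁ v₂ p (s C suc q) (s C suc (suc q)) ⟩
    (v₁ + p * (s C suc (suc q))) + (v₂ + p * (s C suc q))
      ≡⟨ cong₂ _+_
           (visits-ballot n t ρ (suc q) (2 + a) (suc-injective n≡)
             (trans q≡ (lemma′ t ρ a)))
           (subst (λ s → v₂ + p * (s C suc q) ≡ p * (s C q)) (sym (+-suc t q))
             (visits-ballot n (suc t) ρ q a (suc-injective (trans n≡ (+-suc (suc t + ρ) (suc q))))
               (suc-injective (trans q≡ (+-suc (suc t + ρ) a))))) ⟩
    p * (s C suc q) + p * (s C q)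
      ≡⟨ trans (sym (*-distribˡ-+ p (s C suc q) (s C q))) (cong (p *_) (+-comm (s C suc q) (s C q))) ⟩
    p * (s C q + s C suc q)
      ≡⟨ cong (p *_) (pascal s q) ⟨
    p * (suc s C suc q) ∎
    where
    p = 2 ^ ρ
    s = t + suc q
    v₁ = visits n (suc (suc a)) (suc ρ)
    v₂ = visits n a (suc ρ)
    lemma′ : ∀ t ρ a → suc (t + ρ + suc a) ≡ t + ρ + suc (suc a)
    lemma′ = solve-∀
    lemma : ∀ v w p x y → v + w + p * (x + y) ≡ (v + p * y) + (w + p * x)
    lemma = solve-∀

  -- Absorption and trinomial identities.

  -- This is (k + 1) C(n, k + 1) = (n - k) C(n, k) without subtraction, and so valid for k > n as
  -- well.
  [1+k]*nC[1+k]+k*nCk≡n*nCk : ∀ n k → suc k * (n C suc k) + k * (n C k) ≡ n * (n C k)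
  [1+k]*nC[1+k]+k*nCk≡n*nCk zero    zero    = refl
  [1+k]*nC[1+k]+k*nCk≡n*nCk zero    (suc k)
    rewrite k>n⇒nCk≡0 {0} {suc k} z<s | k>n⇒nCk≡0 {0} {suc (suc k)} z<s
    = cong₂ _+_ (*-zeroʳ k) (*-zeroʳ k)
  [1+k]*nC[1+k]+k*nCk≡n*nCk (suc n) zero    = begin
    1 * (suc n C 1) + 0 ≡⟨ trans (+-identityʳ _) (*-identityˡ _) ⟩
    suc n C 1           ≡⟨ nC1≡n (suc n) ⟩
    suc n               ≡⟨ *-identityʳ (suc n) ⟨
    suc n * 1           ∎
  [1+k]*nC[1+k]+k*nCk≡n*nCk (suc n) (suc k) = begin
    suc (suc k) * (suc n C suc (suc k)) + suc k * (suc n C suc k)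
      ≡⟨ cong₂ (λ x y → suc (suc k) * x + suc k * y) (pascal n (suc k)) (pascal n k) ⟩
    suc (suc k) * (y + z) + suc k * (x + y)
      ≡⟨ lemma k x y z ⟩
    (suc (suc k) * z + suc k * y) + (suc k * y + k * x) + (x + y)
      ≡⟨ cong₂ (λ a b → a + b + (x + y)) ([1+k]*nC[1+k]+k*nCk≡n*nCk n (suc k)) ([1+k]*nC[1+k]+k*nCk≡n*nCk n k) ⟩
    n * y + n * x + (x + y)
      ≡⟨ lemma′ n x y ⟩
    suc n * (x + y)
      ≡⟨ cong (suc n *_) (pascal n k) ⟨
    suc n * (suc n C suc k) ∎
    where
    x = n C k
    y = n C suc k
    z = n C suc (suc k)
    lemma : ∀ k x y z → suc (suc k) * (y + z) + suc k * (x + y) ≡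
                        (suc (suc k) * z + suc k * y) + (suc k * y + k * x) + (x + y)
    lemma = solve-∀
    lemma′ : ∀ n x y → n * y + n * x + (x + y) ≡ suc n * (x + y)
    lemma′ = solve-∀

  [1+k]*[1+n]C[1+k]≡[1+n]*nCk : ∀ n k → suc k * (suc n C suc k) ≡ suc n * (n C k)
  [1+k]*[1+n]C[1+k]≡[1+n]*nCk n k = begin
    suc k * (suc n C suc k)                   ≡⟨ cong (suc k *_) (pascal n k) ⟩
    suc k * (x + y)                           ≡⟨ lemma k x y ⟩
    x + (suc k * y + k * x)                   ≡⟨ cong (x +_) ([1+k]*nC[1+k]+k*nCk≡n*nCk n k) ⟩
    suc n * x                                 ∎
    where
    x = n C k
    y = n C suc k
    lemma : ∀ k x y → suc k * (x + y) ≡ x + (suc k * y + k * x)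
    lemma = solve-∀

  -- Both sides are the multinomial coefficient (a + b + c)! / (a! b! c!).
  trinomial : ∀ a b c → ((a + (b + c)) C a) * ((b + c) C b) ≡ ((a + b + c) C (a + b)) * ((a + b) C a)
  trinomial a b c = *-cancelʳ-≡ _ _ (a ! * (b ! * c !)) {{m*n≢0 (a !) (b ! * c !) {{a !≢0}} {{b !* c !≢0}}}} (begin
    x * y * (a ! * (b ! * c !))      ≡⟨ lemma x y (a !) (b !) (c !) ⟩
    x * (a ! * (y * (b ! * c !)))    ≡⟨ cong (λ z → x * (a ! * z)) ([m+n]Cm*m!*n!≡[m+n]! b c) ⟩
    x * (a ! * (b + c) !)            ≡⟨ [m+n]Cm*m!*n!≡[m+n]! a (b + c) ⟩
    (a + (b + c)) !                  ≡⟨ cong _! (+-assoc a b c) ⟨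
    (a + b + c) !                    ≡⟨ [m+n]Cm*m!*n!≡[m+n]! (a + b) c ⟨
    z * ((a + b) ! * c !)            ≡⟨ cong (λ x → z * (x * c !)) ([m+n]Cm*m!*n!≡[m+n]! a b) ⟨
    z * (w * (a ! * b !) * c !)      ≡⟨ lemma′ z w (a !) (b !) (c !) ⟩
    z * w * (a ! * (b ! * c !))      ∎)
    where
    x = (a + (b + c)) C a
    y = (b + c) C b
    z = (a + b + c) C (a + b)
    w = (a + b) C a
    lemma : ∀ x y a b c → x * y * (a * (b * c)) ≡ x * (a * (y * (b * c)))
    lemma = solve-∀
    lemma′ : ∀ z w a b c → z * (w * (a * b) * c) ≡ z * w * (a * (b * c))
    lemma′ = solve-∀

  -- Absorption turns (ρ + 1) C(n, ρ + 1) into (n - ρ) C(n, ρ) with n - ρ = t + q + 1, a second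
  -- absorption moves this factor into the other binomial, and `trinomial` for n = ρ + t + (q + 1)
  -- splits off `n C u`. This handles the positive term of the ballot number.
  absorb₁ : ∀ ρ t q → let n = ρ + t + suc q; u = ρ + t in
    suc ρ * (n C suc ρ) * ((t + q) C q) ≡ suc q * ((u C ρ) * (n C u))
  absorb₁ ρ t q = begin
    suc ρ * (n C suc ρ) * ((t + q) C q)
      ≡⟨ cong (_* ((t + q) C q)) (+-cancelʳ-≡ (ρ * (n C ρ)) _ _ (trans ([1+k]*nC[1+k]+k*nCk≡n*nCk n ρ) (lemma₁ ρ t q (n C ρ)))) ⟩
    suc (t + q) * (n C ρ) * ((t + q) C q)
      ≡⟨ lemma₂ (suc (t + q)) (n C ρ) ((t + q) C q) ⟩
    (n C ρ) * (suc (t + q) * ((t + q) C q))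
      ≡⟨ cong ((n C ρ) *_) ([1+k]*[1+n]C[1+k]≡[1+n]*nCk (t + q) q) ⟨
    (n C ρ) * (suc q * (suc (t + q) C suc q))
      ≡⟨ cong₂ (λ x y → (x C ρ) * (suc q * y)) (+-assoc ρ t (suc q))
           (trans (cong (_C suc q) (sym (+-suc t q))) (sym ([m+n]Cm≡[m+n]Cn t (suc q)))) ⟩
    ((ρ + (t + suc q)) C ρ) * (suc q * ((t + suc q) C t))
      ≡⟨ lemma₃ ((ρ + (t + suc q)) C ρ) (suc q) ((t + suc q) C t) ⟩
    suc q * (((ρ + (t + suc q)) C ρ) * ((t + suc q) C t))
      ≡⟨ cong (suc q *_) (trans (trinomial ρ t (suc q)) (*-comm (n C u) (u C ρ))) ⟩
    suc q * ((u C ρ) * (n C u)) ∎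
    where
    n = ρ + t + suc q
    u = ρ + t
    lemma₁ : ∀ ρ t q x → (ρ + t + suc q) * x ≡ suc (t + q) * x + ρ * x
    lemma₁ = solve-∀
    lemma₂ : ∀ x y z → x * y * z ≡ y * (x * z)
    lemma₂ = solve-∀
    lemma₃ : ∀ x y z → x * (y * z) ≡ y * (x * z)
    lemma₃ = solve-∀

  -- The negative term of the ballot number: `trinomial` for n = (ρ + 1) + (t - 1) + (q + 1). For
  -- `t` zero both sides vanish.
  absorb₂ : ∀ ρ t q → let n = ρ + t + suc q; u = ρ + t in
    (n C suc ρ) * ((t + q) C suc q) ≡ (u C suc ρ) * (n C u)
  absorb₂ ρ zero q
    rewrite +-identityʳ ρ | k>n⇒nCk≡0 (n<1+n q) | k>n⇒nCk≡0 (n<1+n ρ) = *-zeroʳ ((ρ + suc q) C suc ρ)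
  absorb₂ ρ (suc t) q = begin
    ((ρ + suc t + suc q) C suc ρ) * ((suc t + q) C suc q)
      ≡⟨ cong₂ (λ x y → (x C suc ρ) * y)
           (trans (cong (_+ suc q) (+-suc ρ t)) (cong suc (+-assoc ρ t (suc q))))
           (trans (cong (_C suc q) (sym (+-suc t q))) (sym ([m+n]Cm≡[m+n]Cn t (suc q)))) ⟩
    ((suc ρ + (t + suc q)) C suc ρ) * ((t + suc q) C t)
      ≡⟨ trinomial (suc ρ) t (suc q) ⟩
    ((suc ρ + t + suc q) C (suc ρ + t)) * ((suc ρ + t) C suc ρ)
      ≡⟨ *-comm ((suc ρ + t + suc q) C (suc ρ + t)) ((suc ρ + t) C suc ρ) ⟩
    ((suc ρ + t) C suc ρ) * ((suc ρ + t + suc q) C (suc ρ + t))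
      ≡⟨ cong (λ u → (u C suc ρ) * ((u + suc q) C u)) (+-suc ρ t) ⟨
    ((ρ + suc t) C suc ρ) * ((ρ + suc t + suc q) C (ρ + suc t)) ∎

  u<ρ⇒visits≡0 : ∀ u q a ρ → suc q ≡ u + a → u < ρ → visits (u + suc q) a (suc ρ) ≡ 0
  u<ρ⇒visits≡0 u q a ρ q≡ u<ρ = n+2<a+2r⇒visits≡0 (u + suc q) a (suc ρ)
    (subst (_< a + 2 * suc ρ) (sym (trans (cong (λ x → u + x + 2) q≡) (lemma u a)))
      (+-monoʳ-< a (*-monoʳ-< 2 (s<s u<ρ))))
    where
    lemma : ∀ u a → u + (u + a) + 2 ≡ a + 2 * suc u
    lemma = solve-∀

  -- `visits-ballot` with denominators cleared: dividing by `n C u` and by r (n C r) leaves a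
  -- formula in which the start enters only through `u`. It also covers u < ρ, where no `t` exists
  -- and everything vanishes.
  visits-weighted : ∀ u q a ρ → suc q ≡ u + a → let n = u + suc q in
    visits n a (suc ρ) * (suc ρ * (n C suc ρ)) + 2 ^ ρ * (suc ρ * (u C suc ρ)) * (n C u)
      ≡ 2 ^ ρ * (suc q * (u C ρ)) * (n C u)
  visits-weighted u q a ρ q≡ with ρ ≤? u
  ... | no ρ≰u
    rewrite u<ρ⇒visits≡0 u q a ρ q≡ (≰⇒> ρ≰u)
          | k>n⇒nCk≡0 (≰⇒> ρ≰u) | k>n⇒nCk≡0 (m≤n⇒m≤1+n (≰⇒> ρ≰u))
          | *-zeroʳ ρ | *-zeroʳ q = refl
  ... | yes ρ≤u with t , refl ← m≤n⇒∃[o]m+o≡n ρ≤u = begin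
    v * (suc ρ * N) + p * (suc ρ * (u C suc ρ)) * (n C u)
      ≡⟨ lemma₁ v (suc ρ) N p (u C suc ρ) (n C u) ⟩
    v * (suc ρ * N) + p * suc ρ * ((u C suc ρ) * (n C u))
      ≡⟨ cong (λ x → v * (suc ρ * N) + p * suc ρ * x) (absorb₂ ρ t q) ⟨
    v * (suc ρ * N) + p * suc ρ * (N * ((t + q) C suc q))
      ≡⟨ lemma₂ v (suc ρ) N p ((t + q) C suc q) ⟩
    (v + p * ((t + q) C suc q)) * (suc ρ * N)
      ≡⟨ cong (_* (suc ρ * N)) (visits-ballot n t ρ q a (cong (_+ suc q) (+-comm ρ t)) (trans q≡ (cong (_+ a) (+-comm ρ t)))) ⟩
    p * ((t + q) C q) * (suc ρ * N)
      ≡⟨ lemma₃ p ((t + q) C q) (suc ρ * N) ⟩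
    p * (suc ρ * N * ((t + q) C q))
      ≡⟨ cong (p *_) (absorb₁ ρ t q) ⟩
    p * (suc q * ((u C ρ) * (n C u)))
      ≡⟨ lemma₄ p (suc q) (u C ρ) (n C u) ⟩
    p * (suc q * (u C ρ)) * (n C u) ∎
    where
    n = u + suc q
    N = n C suc ρ
    p = 2 ^ ρ
    v = visits n a (suc ρ)
    lemma₁ : ∀ v r N p x y → v * (r * N) + p * (r * x) * y ≡ v * (r * N) + p * r * (x * y)
    lemma₁ = solve-∀
    lemma₂ : ∀ v r N p x → v * (r * N) + p * r * (N * x) ≡ (v + p * x) * (r * N)
    lemma₂ = solve-∀
    lemma₃ : ∀ p x y → p * x * y ≡ p * (y * x)
    lemma₃ = solve-∀
    lemma₄ : ∀ p x y z → p * (x * (y * z)) ≡ p * (x * y) * z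
    lemma₄ = solve-∀

open import Data.Integer using (+_)
open import Data.Nat using (ℕ; suc; _∸_; _^_; _≤_; _<_; _≥_; NonZero; ⌊_/2⌋; ⌈_/2⌉; _≟_) renaming (_*_ to _*ℕ_)
open import Data.Nat.Combinatorics using (_C_)
open import Data.Nat.Divisibility using (_∣?_)
open import Data.Product using (_×_)
open import Data.Rational using (ℚ; 0ℚ; _+_; _*_; _/_)
open import Data.Sum using (_⊎_)
open import Relation.Binary.PropositionalEquality using (_≡_)
open import Defs

open import Data.Bool using (Bool; true; false; if_then_else_; _∧_)
open import Data.Bool.Properties using (∧-zeroʳ)
open import Data.Integer as ℤ using (ℤ; -[1+_]; 0ℤ; ∣_∣)
import Data.Integer.Properties as ℤ
import Data.Integer.Tactic.RingSolver as ℤ-Solver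
open import Data.List using (List; []; _∷_; _++_; map; filter; foldr; length; applyUpTo)
open import Data.List.Properties using (length-map; length-applyUpTo)
open import Data.Nat as ℕ using (zero)
open import Data.Nat.Divisibility using (_∣_; divides; ∣m+n∣m⇒∣n; ∣1⇒≡1)
import Data.Nat.Properties as ℕ
import Data.Nat.Tactic.RingSolver as ℕ-Solver
open import Data.Product using (_,_; ∃)
open import Data.Rational using (1ℚ; _-_; fromℚᵘ)
open import Data.Rational.Properties using (toℚᵘ-injective; toℚᵘ-fromℚᵘ; fromℚᵘ-cong; toℚᵘ-homo-+; toℚᵘ-homo-*; +-identityˡ; +-identityʳ; +-assoc; +-comm; *-identityˡ; *-identityʳ; *-zeroˡ; *-zeroʳ; *-distribˡ-+; *-distribʳ-+)
open import Data.Rational.Solver using (module +-*-Solver)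
import Data.Rational.Unnormalised as ℚᵘ
import Data.Rational.Unnormalised.Properties as ℚᵘ
open import Data.Sum using (inj₁; inj₂)
open import Data.Vec using (Vec; []; _∷_)
open import Function using (_∘_)
open import Level using (Level)
open import Relation.Binary.PropositionalEquality using (refl; sym; trans; cong; cong₂; subst; _≗_; module ≡-Reasoning)
open import Relation.Nullary using (Dec; ¬_; does)
open import Relation.Nullary.Decidable using (dec-true; dec-false)
open import Relation.Unary using (Pred; Decidable)
open +-*-Solver using (solve; _:=_; _:+_; _:*_; _:-_; con)
open ≡-Reasoning
open PathCounts

private
  variable
    ℓ ℓ′ : Level
    A B : Set ℓ

-- Fractions of natural numbers in ℚ.

-- A fraction `+ m / suc n` is `fromℚᵘ` of an unnormalised one, so identities between fractions
-- reduce to integer cross-multiplication.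
fromℚᵘ-homo-+ : ∀ p q → fromℚᵘ (p ℚᵘ.+ q) ≡ fromℚᵘ p + fromℚᵘ q
fromℚᵘ-homo-+ p q = toℚᵘ-injective (ℚᵘ.≃-trans (toℚᵘ-fromℚᵘ (p ℚᵘ.+ q)) (ℚᵘ.≃-sym
  (ℚᵘ.≃-trans (toℚᵘ-homo-+ (fromℚᵘ p) (fromℚᵘ q)) (ℚᵘ.+-cong (toℚᵘ-fromℚᵘ p) (toℚᵘ-fromℚᵘ q)))))

fromℚᵘ-homo-* : ∀ p q → fromℚᵘ (p ℚᵘ.* q) ≡ fromℚᵘ p * fromℚᵘ q
fromℚᵘ-homo-* p q = toℚᵘ-injective (ℚᵘ.≃-trans (toℚᵘ-fromℚᵘ (p ℚᵘ.* q)) (ℚᵘ.≃-sym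
  (ℚᵘ.≃-trans (toℚᵘ-homo-* (fromℚᵘ p) (fromℚᵘ q)) (ℚᵘ.*-cong (toℚᵘ-fromℚᵘ p) (toℚᵘ-fromℚᵘ q)))))

-- The encoding of fractions as ι m * inv n makes the closing identities polynomial; opacity keeps
-- the gcd computations inside _/_ from being unfolded.
opaque

  ι : ℕ → ℚ
  ι n = + n / 1

  inv : ℕ → ℚ
  inv zero    = 0ℚ
  inv (suc n) = + 1 / suc n

  ι-0 : ι 0 ≡ 0ℚ
  ι-0 = refl

  ι-1 : ι 1 ≡ 1ℚ
  ι-1 = refl

  inv-suc : ∀ n → inv (suc n) ≡ + 1 / suc n
  inv-suc n = refl

  ι-+ : ∀ m n → ι (m ℕ.+ n) ≡ ι m + ι n
  ι-+ m n = trans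
    (fromℚᵘ-cong {ℚᵘ.mkℚᵘ (+ (m ℕ.+ n)) 0} {ℚᵘ.mkℚᵘ (+ m) 0 ℚᵘ.+ ℚᵘ.mkℚᵘ (+ n) 0} (ℚᵘ.*≡* (lemma (+ m) (+ n))))
    (fromℚᵘ-homo-+ (ℚᵘ.mkℚᵘ (+ m) 0) (ℚᵘ.mkℚᵘ (+ n) 0))
    where
    lemma : ∀ x y → (x ℤ.+ y) ℤ.* + 1 ≡ (x ℤ.* + 1 ℤ.+ y ℤ.* + 1) ℤ.* + 1
    lemma = ℤ-Solver.solve-∀

  ι-* : ∀ m n → ι (m ℕ.* n) ≡ ι m * ι n
  ι-* m n = trans
    (fromℚᵘ-cong {ℚᵘ.mkℚᵘ (+ (m ℕ.* n)) 0} {ℚᵘ.mkℚᵘ (+ m) 0 ℚᵘ.* ℚᵘ.mkℚᵘ (+ n) 0}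
      (ℚᵘ.*≡* (cong (ℤ._* + 1) (ℤ.pos-* m n))))
    (fromℚᵘ-homo-* (ℚᵘ.mkℚᵘ (+ m) 0) (ℚᵘ.mkℚᵘ (+ n) 0))

  +/≡ι*inv : ∀ m n .{{_ : NonZero n}} → + m / n ≡ ι m * inv n
  +/≡ι*inv m (suc n) = trans
    (fromℚᵘ-cong {ℚᵘ.mkℚᵘ (+ m) n} {ℚᵘ.mkℚᵘ (+ m) 0 ℚᵘ.* ℚᵘ.mkℚᵘ (+ 1) n}
      (ℚᵘ.*≡* (lemma (+ m) (+ suc n))))
    (fromℚᵘ-homo-* (ℚᵘ.mkℚᵘ (+ m) 0) (ℚᵘ.mkℚᵘ (+ 1) n))
    where
    lemma : ∀ x y → x ℤ.* (+ 1 ℤ.* y) ≡ x ℤ.* + 1 ℤ.* y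
    lemma = ℤ-Solver.solve-∀

  ι*inv≡1 : ∀ n .{{_ : NonZero n}} → ι n * inv n ≡ 1ℚ
  ι*inv≡1 (suc n) = trans (sym (+/≡ι*inv (suc n) (suc n)))
    (fromℚᵘ-cong {ℚᵘ.mkℚᵘ (+ suc n) n} {ℚᵘ.mkℚᵘ (+ 1) 0} (ℚᵘ.*≡* (ℤ.*-comm (+ suc n) (+ 1))))

  -- The default `inv zero = 0ℚ` makes this hold without nonzero conditions.
  inv-* : ∀ m n → inv (m ℕ.* n) ≡ inv m * inv n
  inv-* zero    n       = sym (*-zeroˡ (inv n))
  inv-* (suc m) zero    = trans (cong inv (ℕ.*-zeroʳ m)) (sym (*-zeroʳ (inv (suc m))))
  inv-* (suc m) (suc n) = fromℚᵘ-homo-* (ℚᵘ.mkℚᵘ (+ 1) m) (ℚᵘ.mkℚᵘ (+ 1) n)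

ι-*₃ : ∀ a b c → ι (a ℕ.* (b ℕ.* c)) ≡ ι a * (ι b * ι c)
ι-*₃ a b c = trans (ι-* a (b ℕ.* c)) (cong (ι a *_) (ι-* b c))

-- Counting in lists and probabilities in finite distributions.

countᵇ : (A → Bool) → List A → ℕ
countᵇ p []       = 0
countᵇ p (x ∷ xs) = if p x then suc (countᵇ p xs) else countᵇ p xs

countᵇ-cong : {p q : A → Bool} → p ≗ q → countᵇ p ≗ countᵇ q
countᵇ-cong         eq []       = refl
countᵇ-cong {q = q} eq (x ∷ xs) rewrite eq x with q x
... | true  = cong suc (countᵇ-cong eq xs)
... | false = countᵇ-cong eq xs

countᵇ-false : (xs : List A) → countᵇ (λ _ → false) xs ≡ 0
countᵇ-false []       = refl
countᵇ-false (x ∷ xs) = countᵇ-false xs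

countᵇ-map : ∀ (p : B → Bool) (f : A → B) xs → countᵇ p (map f xs) ≡ countᵇ (p ∘ f) xs
countᵇ-map p f []       = refl
countᵇ-map p f (x ∷ xs) with p (f x)
... | true  = cong suc (countᵇ-map p f xs)
... | false = countᵇ-map p f xs

countᵇ-++ : ∀ (p : A → Bool) xs ys → countᵇ p (xs ++ ys) ≡ countᵇ p xs ℕ.+ countᵇ p ys
countᵇ-++ p []       ys = refl
countᵇ-++ p (x ∷ xs) ys with p x
... | true  = cong suc (countᵇ-++ p xs ys)
... | false = countᵇ-++ p xs ys

length-filter≡countᵇ : {P : Pred A ℓ′} (P? : Decidable P) → ∀ xs → length (filter P? xs) ≡ countᵇ (does ∘ P?) xs
length-filter≡countᵇ P? []       = refl
length-filter≡countᵇ P? (x ∷ xs) with does (P? x)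
... | true  = cong suc (length-filter≡countᵇ P? xs)
... | false = length-filter≡countᵇ P? xs

countᵇ-filter : ∀ {Q : Pred A ℓ′} p (Q? : Decidable Q) xs → countᵇ p (filter Q? xs) ≡ countᵇ (λ x → does (Q? x) ∧ p x) xs
countᵇ-filter p Q? []       = refl
countᵇ-filter p Q? (x ∷ xs) with does (Q? x)
... | false = countᵇ-filter p Q? xs
... | true with p x
...   | true  = cong suc (countᵇ-filter p Q? xs)
...   | false = countᵇ-filter p Q? xs

module _ {P : Pred A ℓ′} (P? : Decidable P) where

  Prob-++ : ∀ d e → Prob P? (d ++ e) ≡ Prob P? d + Prob P? e
  Prob-++ []            e = sym (+-identityˡ (Prob P? e))
  Prob-++ ((x , w) ∷ d) e = trans (cong (λ s → ⟦ P? x ⟧ * w + s) (Prob-++ d e)) (sym (+-assoc (⟦ P? x ⟧ * w) _ _))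

  Prob-scale : ∀ w d → Prob P? (map (λ (y , v) → y , w * v) d) ≡ w * Prob P? d
  Prob-scale w []            = sym (*-zeroʳ w)
  Prob-scale w ((x , v) ∷ d) = trans (cong (λ s → ⟦ P? x ⟧ * (w * v) + s) (Prob-scale w d))
    (solve 4 (λ b w v s → b :* (w :* v) :+ w :* s := w :* (b :* v :+ s)) refl ⟦ P? x ⟧ w v (Prob P? d))

  Prob->>= : ∀ (d : Dist B) k → Prob P? (d >>= k) ≡ foldr (λ (x , w) acc → w * Prob P? (k x) + acc) 0ℚ d
  Prob->>= []            k = refl
  Prob->>= ((x , w) ∷ d) k = trans (Prob-++ (map (λ (y , v) → y , w * v) (k x)) (d >>= k)) (cong₂ _+_ (Prob-scale w (k x)) (Prob->>= d k))

  Prob-const : ∀ w xs → Prob P? (map (_, w) xs) ≡ ι (countᵇ (does ∘ P?) xs) * w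
  Prob-const w []       = sym (trans (cong (_* w) ι-0) (*-zeroˡ w))
  Prob-const w (x ∷ xs) with does (P? x)
  ... | true  = trans (cong (λ s → 1ℚ * w + s) (Prob-const w xs)) (trans (sym (*-distribʳ-+ w 1ℚ (ι c)))
      (cong (_* w) (trans (cong (_+ ι c) (sym ι-1)) (sym (ι-+ 1 c)))))
    where c = countᵇ (does ∘ P?) xs
  ... | false = trans (cong (λ s → 0ℚ * w + s) (Prob-const w xs)) (solve 2 (λ x w → con 0ℚ :* w :+ x := x) refl _ w)

  Prob-uniform : ∀ xs n .{{_ : NonZero n}} → length xs ≡ n → Prob P? (uniform xs) ≡ ι (countᵇ (does ∘ P?) xs) * inv n
  Prob-uniform (x ∷ xs) n refl = trans
    (cong (λ w → Prob P? (map (_, w) (x ∷ xs))) (sym (inv-suc (length xs))))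
    (Prob-const (inv n) (x ∷ xs))

-- Finite sums of rationals.

Σ< : ℕ → (ℕ → ℚ) → ℚ
Σ< zero    f = 0ℚ
Σ< (suc n) f = Σ< n f + f n

Σ<-cong : ∀ n {f g} → (∀ i → i ℕ.< n → f i ≡ g i) → Σ< n f ≡ Σ< n g
Σ<-cong zero    eq = refl
Σ<-cong (suc n) eq = cong₂ _+_ (Σ<-cong n (λ i i<n → eq i (ℕ.m<n⇒m<1+n i<n))) (eq n ℕ.≤-refl)

Σ<-head : ∀ n f → Σ< (suc n) f ≡ f 0 + Σ< n (f ∘ suc)
Σ<-head zero    f = +-comm 0ℚ (f 0)
Σ<-head (suc n) f = trans (cong (_+ f (suc n)) (Σ<-head n f)) (+-assoc (f 0) _ _)

Σ<-+ : ∀ m n f → Σ< (m ℕ.+ n) f ≡ Σ< m f + Σ< n (f ∘ (m ℕ.+_))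
Σ<-+ m zero    f = trans (cong (λ k → Σ< k f) (ℕ.+-identityʳ m)) (sym (+-identityʳ (Σ< m f)))
Σ<-+ m (suc n) f = trans (cong (λ k → Σ< k f) (ℕ.+-suc m n))
  (trans (cong (_+ f (m ℕ.+ n)) (Σ<-+ m n f)) (+-assoc (Σ< m f) _ _))

Σ<-reverse : ∀ n f → Σ< n f ≡ Σ< n (λ i → f (n ℕ.∸ suc i))
Σ<-reverse zero    f = refl
Σ<-reverse (suc n) f = trans (cong (_+ f n) (Σ<-reverse n f))
  (trans (+-comm _ (f n)) (sym (Σ<-head n (λ i → f (n ℕ.∸ i)))))

Σ<-0 : ∀ n → Σ< n (λ _ → 0ℚ) ≡ 0ℚ
Σ<-0 zero    = refl
Σ<-0 (suc n) = trans (+-identityʳ _) (Σ<-0 n)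

Σ<-*ˡ : ∀ c n f → Σ< n (λ i → c * f i) ≡ c * Σ< n f
Σ<-*ˡ c zero    f = sym (*-zeroʳ c)
Σ<-*ˡ c (suc n) f = trans (cong (_+ c * f n) (Σ<-*ˡ c n f)) (sym (*-distribˡ-+ c (Σ< n f) (f n)))

-- `h` is general for the induction: `applyUpTo` recurses by replacing it with `h ∘ suc`.
mean-applyUpTo : ∀ (F : A → ℚ) (g : B → A) w h n →
  foldr (λ (x , w) acc → w * F x + acc) 0ℚ (map (_, w) (map g (applyUpTo h n))) ≡ w * Σ< n (F ∘ g ∘ h)
mean-applyUpTo F g w h zero    = sym (*-zeroʳ w)
mean-applyUpTo F g w h (suc n) = trans (cong (λ s → w * F (g (h 0)) + s) (mean-applyUpTo F g w (h ∘ suc) n))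
  (trans (sym (*-distribˡ-+ w _ _)) (cong (w *_) (sym (Σ<-head n (F ∘ g ∘ h)))))

-- Counting step sequences by end height and zeros.

endHeight-∷ : ∀ {n} s d (ds : Vec Step n) → endHeight (path s (d ∷ ds)) ≡ endHeight (path (s ℤ.+ Δ d) ds)
endHeight-∷ s d []      = refl
endHeight-∷ s d (_ ∷ _) = refl

returns : ∀ {n} → ℤ → Vec Step n → Bool
returns s ds = does (endHeight (path s ds) ℤ.≟ 0ℤ)

returnsWith : ∀ {n} → ℕ → ℤ → Vec Step n → Bool
returnsWith r s ds = returns s ds ∧ does (zeros (path s ds) ℕ.≟ r)

countᵇ-allSteps : ∀ n p → countᵇ p (allSteps (suc n)) ≡ countᵇ (p ∘ (↗ ∷_)) (allSteps n) ℕ.+ countᵇ (p ∘ (↘ ∷_)) (allSteps n)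
countᵇ-allSteps n p = trans (countᵇ-++ p (map (↗ ∷_) (allSteps n)) _)
  (cong₂ ℕ._+_ (countᵇ-map p (↗ ∷_) (allSteps n)) (countᵇ-map p (↘ ∷_) (allSteps n)))

returns-∷ : ∀ {n} s d (ds : Vec Step n) → returns s (d ∷ ds) ≡ returns (s ℤ.+ Δ d) ds
returns-∷ s d ds = cong (λ h → does (h ℤ.≟ 0ℤ)) (endHeight-∷ s d ds)

countᵇ-returns-suc : ∀ n s → countᵇ (returns s) (allSteps (suc n)) ≡
  countᵇ (returns (s ℤ.+ + 1)) (allSteps n) ℕ.+ countᵇ (returns (s ℤ.+ -[1+ 0 ])) (allSteps n)
countᵇ-returns-suc n s = trans (countᵇ-allSteps n (returns s))
  (cong₂ ℕ._+_ (countᵇ-cong (returns-∷ s ↗) (allSteps n)) (countᵇ-cong (returns-∷ s ↘) (allSteps n)))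

-- The start lies at depth n + j + 1, too deep for `n` steps.
countᵇ-returns-low : ∀ n j → countᵇ (returns -[1+ n ℕ.+ j ]) (allSteps n) ≡ 0
countᵇ-returns-low zero    j = refl
countᵇ-returns-low (suc n) j = trans (countᵇ-returns-suc n -[1+ suc n ℕ.+ j ])
  (cong₂ ℕ._+_ (countᵇ-returns-low n j)
    (trans (cong (λ k → countᵇ (returns -[1+ k ]) (allSteps n)) (eq n j)) (countᵇ-returns-low n (2 ℕ.+ j))))
  where
  eq : ∀ n j → suc (suc (n ℕ.+ j) ℕ.+ 0) ≡ n ℕ.+ (2 ℕ.+ j)
  eq n j = trans (cong suc (ℕ.+-identityʳ _)) (sym (trans (ℕ.+-suc n (suc j)) (cong suc (ℕ.+-suc n j))))

-- From 2k - n, a path to 0 has exactly `k` down-steps. Splitting by the first step gives Pascal's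
-- rule: an up-step keeps `k`, a down-step lowers it by one.
countᵇ-returns : ∀ n k → countᵇ (returns (+ (2 ℕ.* k) ℤ.- + n)) (allSteps n) ≡ n C k
countᵇ-returns zero    zero    = refl
countᵇ-returns zero    (suc k) = refl
countᵇ-returns (suc n) zero    = trans (countᵇ-returns-suc n -[1+ n ])
  (cong₂ ℕ._+_ (trans (cong (λ s → countᵇ (returns s) (allSteps n)) (lemma n)) (countᵇ-returns n 0))
    (trans (cong (λ k → countᵇ (returns -[1+ k ]) (allSteps n)) (trans (cong suc (ℕ.+-identityʳ n)) (ℕ.+-comm 1 n))) (countᵇ-returns-low n 1)))
  where
  lemma : ∀ n → -[1+ n ] ℤ.+ + 1 ≡ + 0 ℤ.- + n
  lemma zero    = refl
  lemma (suc n) = refl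
countᵇ-returns (suc n) (suc k) = begin
  countᵇ (returns s) (allSteps (suc n))
    ≡⟨ countᵇ-returns-suc n s ⟩
  countᵇ (returns (s ℤ.+ + 1)) (allSteps n) ℕ.+ countᵇ (returns (s ℤ.+ -[1+ 0 ])) (allSteps n)
    ≡⟨ cong₂ (λ x y → countᵇ (returns x) (allSteps n) ℕ.+ countᵇ (returns y) (allSteps n)) (up (+ (2 ℕ.* suc k)) (+ n)) down ⟩
  countᵇ (returns (+ (2 ℕ.* suc k) ℤ.- + n)) (allSteps n) ℕ.+ countᵇ (returns (+ (2 ℕ.* k) ℤ.- + n)) (allSteps n)
    ≡⟨ cong₂ ℕ._+_ (countᵇ-returns n (suc k)) (countᵇ-returns n k) ⟩
  n C suc k ℕ.+ n C k
    ≡⟨ trans (ℕ.+-comm (n C suc k) (n C k)) (sym (pascal n k)) ⟩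
  suc n C suc k ∎
  where
  s = + (2 ℕ.* suc k) ℤ.- + suc n
  up : ∀ x y → x ℤ.- (+ 1 ℤ.+ y) ℤ.+ + 1 ≡ x ℤ.- y
  up = ℤ-Solver.solve-∀
  down′ : ∀ x y → (+ 2 ℤ.+ x) ℤ.- (+ 1 ℤ.+ y) ℤ.+ -[1+ 0 ] ≡ x ℤ.- y
  down′ = ℤ-Solver.solve-∀
  down : s ℤ.+ -[1+ 0 ] ≡ + (2 ℕ.* k) ℤ.- + n
  down = trans (cong (λ m → + m ℤ.- + suc n ℤ.+ -[1+ 0 ]) (ℕ.*-suc 2 k)) (down′ (+ (2 ℕ.* k)) (+ n))

-- `r′` is the number of zeros left for the rest of the path: `r` away from height 0, one less at
-- height 0.
countᵇ-returnsWith-suc : ∀ n r s {r′ v₁ v₂} →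
  (∀ d (ds : Vec Step n) → returnsWith r s (d ∷ ds) ≡ returnsWith r′ (s ℤ.+ Δ d) ds) →
  countᵇ (returnsWith r′ (s ℤ.+ + 1)) (allSteps n) ≡ v₁ →
  countᵇ (returnsWith r′ (s ℤ.+ -[1+ 0 ])) (allSteps n) ≡ v₂ →
  countᵇ (returnsWith r s) (allSteps (suc n)) ≡ v₁ ℕ.+ v₂
countᵇ-returnsWith-suc n r s step eq₁ eq₂ = trans (countᵇ-allSteps n (returnsWith r s))
  (cong₂ ℕ._+_ (trans (countᵇ-cong (step ↗) (allSteps n)) eq₁)
               (trans (countᵇ-cong (step ↘) (allSteps n)) eq₂))

countᵇ-returnsWith : ∀ n s r → countᵇ (returnsWith r s) (allSteps n) ≡ visits n ∣ s ∣ r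
countᵇ-returnsWith zero (+ zero)  zero          = refl
countᵇ-returnsWith zero (+ zero)  (suc zero)    = refl
countᵇ-returnsWith zero (+ zero)  (suc (suc r)) = refl
countᵇ-returnsWith zero (+ suc a) r             = refl
countᵇ-returnsWith zero -[1+ a ]  r             = refl
countᵇ-returnsWith (suc n) (+ zero) zero = trans
  -- Matching on the vector lets `heights` unfold, so that the zero at the start becomes visible.
  (countᵇ-cong {q = λ _ → false} (λ where ds@(_ ∷ _) → ∧-zeroʳ (returns (+ 0) ds)) (allSteps (suc n)))
  (countᵇ-false (allSteps (suc n)))
countᵇ-returnsWith (suc n) (+ zero) (suc r) = trans
  (countᵇ-returnsWith-suc n (suc r) (+ 0) {r}
    (λ d ds → cong (_∧ does (zeros (path (+ 0 ℤ.+ Δ d) ds) ℕ.≟ r)) (returns-∷ (+ 0) d ds))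
    (countᵇ-returnsWith n (+ 1) r) (countᵇ-returnsWith n -[1+ 0 ] r))
  (cong (visits n 1 r ℕ.+_) (sym (ℕ.+-identityʳ (visits n 1 r))))
countᵇ-returnsWith (suc n) (+ suc a) r =
  countᵇ-returnsWith-suc n r (+ suc a) {r}
    (λ d ds → cong (_∧ does (zeros (path (+ suc a ℤ.+ Δ d) ds) ℕ.≟ r)) (returns-∷ (+ suc a) d ds))
    (trans (countᵇ-returnsWith n (+ (suc a ℕ.+ 1)) r) (cong (λ b → visits n (suc b) r) (ℕ.+-comm a 1)))
    (countᵇ-returnsWith n (+ a) r)
countᵇ-returnsWith (suc n) -[1+ a ] r = trans
  (countᵇ-returnsWith-suc n r -[1+ a ] {r}
    (λ d ds → cong (_∧ does (zeros (path (-[1+ a ] ℤ.+ Δ d) ds) ℕ.≟ r)) (returns-∷ -[1+ a ] d ds))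
    (trans (countᵇ-returnsWith n (-[1+ a ] ℤ.+ + 1) r) (cong (λ b → visits n b r) (abs a)))
    (trans (countᵇ-returnsWith n -[1+ suc (a ℕ.+ 0) ] r) (cong (λ b → visits n (suc (suc b)) r) (ℕ.+-identityʳ a))))
  -- Below 0 it is the up-step that leads towards height 0, so the summands arrive in the opposite
  -- order.
  (ℕ.+-comm (visits n a r) (visits n (suc (suc a)) r))
  where
  abs : ∀ a → ∣ -[1+ a ] ℤ.+ + 1 ∣ ≡ a
  abs zero    = refl
  abs (suc a) = refl

-- Averaging over the starting height.

startHeight : ℕ → ℕ → ℤ
startHeight n k = + (2 ℕ.* k) ℤ.- + n

length-pathsFrom : ∀ n k → length (pathsFrom n (startHeight n k)) ≡ n C k
length-pathsFrom n k = begin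
  length (pathsFrom n s)                                    ≡⟨ length-filter≡countᵇ (λ P → endHeight P ℤ.≟ 0ℤ) (map (path s) (allSteps n)) ⟩
  countᵇ (λ P → does (endHeight P ℤ.≟ 0ℤ)) (map (path s) (allSteps n)) ≡⟨ countᵇ-map _ (path s) (allSteps n) ⟩
  countᵇ (returns s) (allSteps n)                           ≡⟨ countᵇ-returns n k ⟩
  n C k                                                     ∎
  where s = startHeight n k

Prob-pathsFrom : ∀ n k r → k ℕ.≤ n →
  Prob (λ P → zeros P ℕ.≟ r) (uniform (pathsFrom n (startHeight n k))) ≡ ι (visits n ∣ startHeight n k ∣ r) * inv (n C k)
Prob-pathsFrom n k r k≤n = trans
  (Prob-uniform (λ P → zeros P ℕ.≟ r) (pathsFrom n s) (n C k) {{ℕ.>-nonZero (nCk≥1 n k k≤n)}} (length-pathsFrom n k))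
  (cong (λ c → ι c * inv (n C k)) (begin
    countᵇ (λ P → does (zeros P ℕ.≟ r)) (pathsFrom n s)
      ≡⟨ countᵇ-filter (λ P → does (zeros P ℕ.≟ r)) (λ P → endHeight P ℤ.≟ 0ℤ) (map (path s) (allSteps n)) ⟩
    countᵇ (λ P → does (endHeight P ℤ.≟ 0ℤ) ∧ does (zeros P ℕ.≟ r)) (map (path s) (allSteps n))
      ≡⟨ countᵇ-map _ (path s) (allSteps n) ⟩
    countᵇ (returnsWith r s) (allSteps n)
      ≡⟨ countᵇ-returnsWith n s r ⟩
    visits n ∣ s ∣ r ∎))
  where s = startHeight n k

uniform-startHeights : ∀ n → uniform (startHeights n) ≡ map (_, inv (suc n)) (startHeights n)
uniform-startHeights n = cong (λ w → map (_, w) (startHeights n)) (trans (sym (inv-suc _))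
  (cong (inv ∘ suc) (trans (length-map (startHeight n) (applyUpTo suc n)) (length-applyUpTo suc n))))

-- The law of total probability: each start has weight 1 / (n + 1), and given the start 2k - n the
-- path is uniform among `n C k` paths.
ℙ-formula : ∀ n r → ℙ[Z n ≡ r ] ≡
  inv (suc n) * Σ< (suc n) (λ k → ι (visits n ∣ startHeight n k ∣ r) * inv (n C k))
ℙ-formula n r = begin
  ℙ[Z n ≡ r ]
    ≡⟨ Prob->>= Z≟r (uniform (startHeights n)) (λ s → uniform (pathsFrom n s)) ⟩
  average (uniform (startHeights n))
    ≡⟨ cong average (uniform-startHeights n) ⟩
  average (map (_, inv (suc n)) (startHeights n))
    ≡⟨ mean-applyUpTo F (startHeight n) (inv (suc n)) (λ k → k) (suc n) ⟩
  inv (suc n) * Σ< (suc n) (λ k → F (startHeight n k))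
    ≡⟨ cong (inv (suc n) *_) (Σ<-cong (suc n) (λ k k<1+n → Prob-pathsFrom n k r (ℕ.s≤s⁻¹ k<1+n))) ⟩
  inv (suc n) * Σ< (suc n) (λ k → ι (visits n ∣ startHeight n k ∣ r) * inv (n C k)) ∎
  where
  Z≟r : Decidable (λ (P : Path n) → zeros P ≡ r)
  Z≟r P = zeros P ℕ.≟ r
  F : ℤ → ℚ
  F s = Prob Z≟r (uniform (pathsFrom n s))
  average : Dist ℤ → ℚ
  average = foldr (λ (x , w) acc → w * F x + acc) 0ℚ

-- Conditional probabilities and their telescoping sum.

ι-absorb : ∀ n k → ι (suc k) * ι (n C suc k) + ι k * ι (n C k) ≡ ι n * ι (n C k)
ι-absorb n k = begin
  ι (suc k) * ι (n C suc k) + ι k * ι (n C k)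
    ≡⟨ cong₂ _+_ (ι-* (suc k) (n C suc k)) (ι-* k (n C k)) ⟨
  ι (suc k ℕ.* (n C suc k)) + ι (k ℕ.* (n C k))
    ≡⟨ ι-+ (suc k ℕ.* (n C suc k)) (k ℕ.* (n C k)) ⟨
  ι (suc k ℕ.* (n C suc k) ℕ.+ k ℕ.* (n C k))
    ≡⟨ cong ι ([1+k]*nC[1+k]+k*nCk≡n*nCk n k) ⟩
  ι (n ℕ.* (n C k))
    ≡⟨ ι-* n (n C k) ⟩
  ι n * ι (n C k) ∎

-- The chance of suc ρ zeros given the starting height ±(n − 2 i) is scale ρ n * weight ρ n i, and
-- this weight is telescoping in i.
weight : ℕ → ℕ → ℕ → ℚ
weight ρ n i = (ι n - ι i) * ι (i C ρ) - ι (suc ρ) * ι (i C suc ρ)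

-- By absorption, (ρ - i) C(i, ρ) + (ρ + 1) C(i, ρ + 1) = 0, so the weight equals (n - ρ) C(i, ρ) -
-- 2 (ρ + 1) C(i, ρ + 1). Its coefficients no longer depend on `i`, and Pascal's rule sums each
-- column.
Σ<-weight : ∀ ρ n m → Σ< m (weight ρ n) ≡
  (ι n - ι ρ) * ι (m C suc ρ) - (ι (suc ρ) + ι (suc ρ)) * ι (m C suc (suc ρ))
Σ<-weight ρ n zero    = begin
  0ℚ
    ≡⟨ solve 2 (λ a b → con 0ℚ := a :* con 0ℚ :- b :* con 0ℚ) refl (ι n - ι ρ) (ι (suc ρ) + ι (suc ρ)) ⟩
  (ι n - ι ρ) * 0ℚ - (ι (suc ρ) + ι (suc ρ)) * 0ℚ
    ≡⟨ cong (λ z → (ι n - ι ρ) * z - (ι (suc ρ) + ι (suc ρ)) * z) ι-0 ⟨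
  (ι n - ι ρ) * ι 0 - (ι (suc ρ) + ι (suc ρ)) * ι 0 ∎
Σ<-weight ρ n (suc m) = begin
  Σ< m (weight ρ n) + ((N - M) * x - R * y)
    ≡⟨ cong (_+ ((N - M) * x - R * y)) (Σ<-weight ρ n m) ⟩
  ((N - K) * y - (R + R) * z) + ((N - M) * x - R * y)
    ≡⟨ solve 7 (λ N M K R x y z →
         ((N :- K) :* y :- (R :+ R) :* z) :+ ((N :- M) :* x :- R :* y) :=
         ((N :- K) :* (x :+ y) :- (R :+ R) :* (y :+ z)) :+ ((R :* y :+ K :* x) :- M :* x)) refl N M K R x y z ⟩
  ((N - K) * (x + y) - (R + R) * (y + z)) + ((R * y + K * x) - M * x)
    ≡⟨ cong (λ w → ((N - K) * (x + y) - (R + R) * (y + z)) + (w - M * x)) (ι-absorb m ρ) ⟩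
  ((N - K) * (x + y) - (R + R) * (y + z)) + (M * x - M * x)
    ≡⟨ solve 2 (λ a b → a :+ (b :- b) := a) refl ((N - K) * (x + y) - (R + R) * (y + z)) (M * x) ⟩
  (N - K) * (x + y) - (R + R) * (y + z)
    ≡⟨ cong₂ (λ a b → (N - K) * a - (R + R) * b) (ι-pascal m ρ) (ι-pascal m (suc ρ)) ⟨
  (N - K) * ι (suc m C suc ρ) - (R + R) * ι (suc m C suc (suc ρ)) ∎
  where
  N = ι n
  M = ι m
  K = ι ρ
  R = ι (suc ρ)
  x = ι (m C ρ)
  y = ι (m C suc ρ)
  z = ι (m C suc (suc ρ))
  ι-pascal : ∀ n k → ι (suc n C suc k) ≡ ι (n C k) + ι (n C suc k)
  ι-pascal n k = trans (cong ι (pascal n k)) (ι-+ (n C k) (n C suc k))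

scale : ℕ → ℕ → ℚ
scale ρ n = ι (2 ℕ.^ ρ) * (inv (suc ρ) * inv (n C suc ρ))

visits/C′ : ∀ ρ n u q a .{{_ : NonZero (n C suc ρ)}} → n ≡ u ℕ.+ suc q → suc q ≡ u ℕ.+ a →
  ι (visits n a (suc ρ)) * inv (n C u) ≡ scale ρ n * weight ρ n u
visits/C′ ρ n u q a refl q≡ = begin
  v * iM
    ≡⟨ sym (*-identityʳ (v * iM)) ⟩
  v * iM * 1ℚ
    -- Multiplying by r (n C r) and its inverse produces the left side of `visits-weighted`.
    ≡⟨ cong (v * iM *_) (trans (cong₂ _*_ (ι*inv≡1 (suc ρ)) (ι*inv≡1 (n′ C suc ρ))) (*-identityˡ 1ℚ)) ⟨
  v * iM * ((R * iR) * (N * iN))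
    ≡⟨ solve 10 (λ v iM R iR N iN p y M D → v :* iM :* ((R :* iR) :* (N :* iN)) :=
         ((v :* (R :* N) :+ p :* (R :* y) :* M) :- p :* (R :* y) :* M) :* (iM :* (iR :* iN))) refl v iM R iR N iN p y M D ⟩
  ((v * (R * N) + p * (R * y) * M) - p * (R * y) * M) * (iM * (iR * iN))
    ≡⟨ cong (λ w → (w - p * (R * y) * M) * (iM * (iR * iN))) cast ⟩
  (p * (D * x) * M - p * (R * y) * M) * (iM * (iR * iN))
    ≡⟨ solve 9 (λ p D x M R y iM iR iN → (p :* (D :* x) :* M :- p :* (R :* y) :* M) :* (iM :* (iR :* iN)) :=
         (M :* iM) :* (p :* (iR :* iN) :* (D :* x :- R :* y))) refl p D x M R y iM iR iN ⟩
  (M * iM) * (p * (iR * iN) * (D * x - R * y))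
    ≡⟨ trans (cong (_* (p * (iR * iN) * (D * x - R * y))) (ι*inv≡1 (n′ C u) {{ℕ.>-nonZero (nCk≥1 n′ u (ℕ.m≤m+n u (suc q)))}})) (*-identityˡ _) ⟩
  p * (iR * iN) * (D * x - R * y)
    ≡⟨ cong (λ d → p * (iR * iN) * (d * x - R * y))
         (trans (cong (_- ι u) (ι-+ u (suc q))) (solve 2 (λ u d → u :+ d :- u := d) refl (ι u) D)) ⟨
  p * (iR * iN) * ((ι n′ - ι u) * x - R * y) ∎
  where
  n′ = u ℕ.+ suc q
  v = ι (visits n′ a (suc ρ))
  M = ι (n′ C u)
  iM = inv (n′ C u)
  R = ι (suc ρ)
  iR = inv (suc ρ)
  N = ι (n′ C suc ρ)
  iN = inv (n′ C suc ρ)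
  p = ι (2 ℕ.^ ρ)
  x = ι (u C ρ)
  y = ι (u C suc ρ)
  D = ι (suc q)
  cast : v * (R * N) + p * (R * y) * M ≡ p * (D * x) * M
  cast = begin
    v * (R * N) + p * (R * y) * M
      ≡⟨ cong₂ (λ s t → s + t * M) (ι-*₃ (visits n′ a (suc ρ)) (suc ρ) (n′ C suc ρ)) (ι-*₃ (2 ℕ.^ ρ) (suc ρ) (u C suc ρ)) ⟨
    ι (visits n′ a (suc ρ) ℕ.* (suc ρ ℕ.* (n′ C suc ρ))) + ι (2 ℕ.^ ρ ℕ.* (suc ρ ℕ.* (u C suc ρ))) * M
      ≡⟨ cong (λ t → ι (visits n′ a (suc ρ) ℕ.* (suc ρ ℕ.* (n′ C suc ρ))) + t) (ι-* (2 ℕ.^ ρ ℕ.* (suc ρ ℕ.* (u C suc ρ))) (n′ C u)) ⟨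
    ι (visits n′ a (suc ρ) ℕ.* (suc ρ ℕ.* (n′ C suc ρ))) + ι (2 ℕ.^ ρ ℕ.* (suc ρ ℕ.* (u C suc ρ)) ℕ.* (n′ C u))
      ≡⟨ ι-+ (visits n′ a (suc ρ) ℕ.* (suc ρ ℕ.* (n′ C suc ρ))) (2 ℕ.^ ρ ℕ.* (suc ρ ℕ.* (u C suc ρ)) ℕ.* (n′ C u)) ⟨
    ι (visits n′ a (suc ρ) ℕ.* (suc ρ ℕ.* (n′ C suc ρ)) ℕ.+ 2 ℕ.^ ρ ℕ.* (suc ρ ℕ.* (u C suc ρ)) ℕ.* (n′ C u))
      ≡⟨ cong ι (visits-weighted u q a ρ q≡) ⟩
    ι (2 ℕ.^ ρ ℕ.* (suc q ℕ.* (u C ρ)) ℕ.* (n′ C u))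
      ≡⟨ trans (ι-* (2 ℕ.^ ρ ℕ.* (suc q ℕ.* (u C ρ))) (n′ C u)) (cong (_* M) (ι-*₃ (2 ℕ.^ ρ) (suc q) (u C ρ))) ⟩
    p * (D * x) * M ∎

-- `visits/C′` asks for at least one down-step; u + a = 0 would force n = 0.
visits/C : ∀ ρ n u a .{{_ : NonZero n}} .{{_ : NonZero (n C suc ρ)}} → n ≡ u ℕ.+ (u ℕ.+ a) →
  ι (visits n a (suc ρ)) * inv (n C u) ≡ scale ρ n * weight ρ n u
visits/C ρ (suc n) zero    (suc a) n≡ = visits/C′ ρ (suc n) zero a (suc a) n≡ refl
visits/C ρ (suc n) (suc u) a       n≡ = visits/C′ ρ (suc n) (suc u) (u ℕ.+ a) a n≡ refl

-- Reflecting the two halves of the starting heights.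

startHeight-low : ∀ i a → startHeight (i ℕ.+ (i ℕ.+ a)) i ≡ ℤ.- + a
startHeight-low i a = lemma (+ i) (+ a)
  where
  lemma : ∀ x y → (x ℤ.+ (x ℤ.+ + 0)) ℤ.- (x ℤ.+ (x ℤ.+ y)) ≡ ℤ.- y
  lemma = ℤ-Solver.solve-∀

startHeight-high : ∀ i a → startHeight (i ℕ.+ (i ℕ.+ a)) (i ℕ.+ a) ≡ + a
startHeight-high i a = lemma (+ i) (+ a)
  where
  lemma : ∀ x y → ((x ℤ.+ y) ℤ.+ ((x ℤ.+ y) ℤ.+ + 0)) ℤ.- (x ℤ.+ (x ℤ.+ y)) ≡ y
  lemma = ℤ-Solver.solve-∀

chance : ℕ → ℕ → ℕ → ℚ
chance n r k = ι (visits n ∣ startHeight n k ∣ r) * inv (n C k)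

module _ (ρ n i a : ℕ) .{{n≢0 : NonZero n}} .{{C≢0 : NonZero (n C suc ρ)}} (n≡ : n ≡ i ℕ.+ (i ℕ.+ a)) where

  chance-low : chance n (suc ρ) i ≡ scale ρ n * weight ρ n i
  chance-low = trans
    (cong (λ h → ι (visits n h (suc ρ)) * inv (n C i))
      (trans (cong (λ m → ∣ startHeight m i ∣) n≡) (trans (cong ∣_∣ (startHeight-low i a)) (ℤ.∣-i∣≡∣i∣ (+ a)))))
    (visits/C ρ n i a n≡)

  chance-high : chance n (suc ρ) (i ℕ.+ a) ≡ scale ρ n * weight ρ n i
  chance-high = trans
    (cong₂ (λ h c → ι (visits n h (suc ρ)) * inv c)
      (trans (cong (λ m → ∣ startHeight m (i ℕ.+ a) ∣) n≡) (cong ∣_∣ (startHeight-high i a)))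
      (trans (cong (_C (i ℕ.+ a)) n≡) (trans (sym ([m+n]Cm≡[m+n]Cn i (i ℕ.+ a))) (cong (_C i) (sym n≡)))))
    (visits/C ρ n i a n≡)

-- After reversal, entry `i` of the upper half has index n - i, the mirror image of `i`. The bound
-- 2i ≤ n supplies the common absolute height a = n - 2i.
Σ<-chance : ∀ ρ n l m .{{_ : NonZero n}} .{{_ : NonZero (n C suc ρ)}} →
  suc n ≡ l ℕ.+ m → l ℕ.≤ m → (∀ i → i ℕ.< m → i ℕ.+ i ℕ.≤ n) →
  Σ< (suc n) (chance n (suc ρ)) ≡ scale ρ n * (Σ< l (weight ρ n) + Σ< m (weight ρ n))
Σ<-chance ρ n l m 1+n≡ l≤m 2i≤n = begin
  Σ< (suc n) f
    ≡⟨ cong (λ k → Σ< k f) 1+n≡ ⟩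
  Σ< (l ℕ.+ m) f
    ≡⟨ Σ<-+ l m f ⟩
  Σ< l f + Σ< m (f ∘ (l ℕ.+_))
    ≡⟨ cong (λ s → Σ< l f + s) (Σ<-reverse m (f ∘ (l ℕ.+_))) ⟩
  Σ< l f + Σ< m (λ i → f (l ℕ.+ (m ℕ.∸ suc i)))
    ≡⟨ cong₂ _+_ (Σ<-cong l low) (Σ<-cong m high) ⟩
  Σ< l (λ i → scale ρ n * weight ρ n i) + Σ< m (λ i → scale ρ n * weight ρ n i)
    ≡⟨ cong₂ _+_ (Σ<-*ˡ (scale ρ n) l (weight ρ n)) (Σ<-*ˡ (scale ρ n) m (weight ρ n)) ⟩
  scale ρ n * Σ< l (weight ρ n) + scale ρ n * Σ< m (weight ρ n)
    ≡⟨ *-distribˡ-+ (scale ρ n) (Σ< l (weight ρ n)) (Σ< m (weight ρ n)) ⟨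
  scale ρ n * (Σ< l (weight ρ n) + Σ< m (weight ρ n)) ∎
  where
  f = chance n (suc ρ)
  low : ∀ i → i ℕ.< l → f i ≡ scale ρ n * weight ρ n i
  low i i<l with a , eq ← ℕ.m≤n⇒∃[o]m+o≡n (2i≤n i (ℕ.<-≤-trans i<l l≤m)) =
    chance-low ρ n i a (trans (sym eq) (ℕ.+-assoc i i a))
  high : ∀ i → i ℕ.< m → f (l ℕ.+ (m ℕ.∸ suc i)) ≡ scale ρ n * weight ρ n i
  high i i<m with a , eq ← ℕ.m≤n⇒∃[o]m+o≡n (2i≤n i i<m) =
    trans (cong f (ℕ.+-cancelˡ-≡ i _ _ (ℕ.suc-injective (begin
      suc (i ℕ.+ (l ℕ.+ (m ℕ.∸ suc i)))   ≡⟨ lemma i l (m ℕ.∸ suc i) ⟩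
      l ℕ.+ (suc i ℕ.+ (m ℕ.∸ suc i))     ≡⟨ cong (l ℕ.+_) (ℕ.m+[n∸m]≡n i<m) ⟩
      l ℕ.+ m                             ≡⟨ 1+n≡ ⟨
      suc n                               ≡⟨ cong suc n≡ ⟩
      suc (i ℕ.+ (i ℕ.+ a))               ∎))))
      (chance-high ρ n i a n≡)
    where
    n≡ = trans (sym eq) (ℕ.+-assoc i i a)
    lemma : ∀ i l k → suc (i ℕ.+ (l ℕ.+ k)) ≡ l ℕ.+ (suc i ℕ.+ k)
    lemma = ℕ-Solver.solve-∀

-- The closed form, by parity of the length.

ι-suc : ∀ n → ι (suc n) ≡ 1ℚ + ι n
ι-suc n = trans (ι-+ 1 n) (cong (_+ ι n) ι-1)

ι-2* : ∀ n → ι (2 *ℕ n) ≡ ι n + ι n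
ι-2* n = trans (ι-+ n (n ℕ.+ 0)) (cong (λ m → ι n + ι m) (ℕ.+-identityʳ n))

⟦yes⟧ : {P : Set} (P? : Dec P) → P → ⟦ P? ⟧ ≡ 1ℚ
⟦yes⟧ P? p = cong (if_then 1ℚ else 0ℚ) (dec-true P? p)

⟦no⟧ : {P : Set} (P? : Dec P) → ¬ P → ⟦ P? ⟧ ≡ 0ℚ
⟦no⟧ P? ¬p = cong (if_then 1ℚ else 0ℚ) (dec-false P? ¬p)

even⊎odd : ∀ n → (∃ λ l → n ≡ l ℕ.+ l) ⊎ (∃ λ l → n ≡ suc (l ℕ.+ l))
even⊎odd zero = inj₁ (0 , refl)
even⊎odd (suc n) with even⊎odd n
... | inj₁ (l , eq) = inj₂ (l , cong suc eq)
... | inj₂ (l , eq) = inj₁ (suc l , trans (cong suc eq) (cong suc (sym (ℕ.+-suc l l))))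

module _ (ρ n : ℕ) where

  -- The right side of the theorem in terms of `ι` and `inv`. The parity bracket and the two halves
  -- of `n` are parameters, so that each parity case can insert constants that the ring solver
  -- handles.
  closedForm : ℚ → ℕ → ℕ → ℚ
  closedForm e h k =
    (ι (2 ^ ρ) + ι (2 ^ ρ)) * inv (suc n) * (ι (h C suc ρ) * inv (n C suc ρ))
      * ((ι h + ι h) * (inv (suc ρ) * inv (suc (suc ρ))) + ι ρ * inv (suc (suc ρ)) + e * inv (suc ρ))
    + e * (ι (2 ^ ρ) * ι ρ * (inv (suc ρ) * inv (suc n))) * (ι (k C ρ) * inv (n C suc ρ))

  module _ .{{_ : NonZero (n C suc ρ)}} where

    closedForm≡ : ∀ {e h k} → ⟦ 2 ∣? n ⟧ ≡ e → ⌈ n /2⌉ ≡ h → ⌊ n /2⌋ ≡ k → closedForm e h k ≡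
      (+ (2 ^ suc ρ) / suc n) * (+ (⌈ n /2⌉ C suc ρ) / (n C suc ρ))
        * ((+ (2 *ℕ ⌈ n /2⌉) / (suc ρ *ℕ suc (suc ρ))) + (+ ρ / suc (suc ρ)) + ⟦ 2 ∣? n ⟧ * (+ 1 / suc ρ))
      + ⟦ 2 ∣? n ⟧ * (+ (2 ^ ρ *ℕ ρ) / (suc ρ *ℕ suc n)) * (+ (⌊ n /2⌋ C ρ) / (n C suc ρ))
    closedForm≡ {e} {h} {k} refl refl refl = sym (cong₂ _+_
      (cong₂ _*_
        (cong₂ _*_ (trans (+/≡ι*inv (2 ^ suc ρ) (suc n)) (cong (_* inv (suc n)) (ι-2* (2 ^ ρ))))
                   (+/≡ι*inv (h C suc ρ) (n C suc ρ)))
        (cong₂ _+_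
          (cong₂ _+_
            (trans (+/≡ι*inv (2 *ℕ h) (suc ρ *ℕ suc (suc ρ))) (cong₂ _*_ (ι-2* h) (inv-* (suc ρ) (suc (suc ρ)))))
            (+/≡ι*inv ρ (suc (suc ρ))))
          (cong (e *_) (sym (inv-suc ρ)))))
      (cong₂ _*_
        (cong (e *_) (trans (+/≡ι*inv (2 ^ ρ *ℕ ρ) (suc ρ *ℕ suc n)) (cong₂ _*_ (ι-* (2 ^ ρ) ρ) (inv-* (suc ρ) (suc n)))))
        (+/≡ι*inv (k C ρ) (n C suc ρ))))

-- With r = ρ + 1, absorption gives C(m, r + 1) = (m - r) C(m, r) / (r + 1), and over the common
-- denominator r (r + 1) the numerator is (2m - r)(r + 1) - 2r (m - r) = 2m + r (r - 1). The
-- coefficient 2m - r is n - r + 1 for n = 2m - 1.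
inv-summed : ∀ ρ m → let R = ι (suc ρ); M = ι m in
  inv (suc ρ) * ((M + M - R) * ι (m C suc ρ) - (R + R) * ι (m C suc (suc ρ))) ≡
  ι (m C suc ρ) * ((M + M) * (inv (suc ρ) * inv (suc (suc ρ))) + ι ρ * inv (suc (suc ρ)))
inv-summed ρ m = begin
  iR * ((M + M - R) * y - (R + R) * z)
    ≡⟨ cong₂ (λ s t → iR * ((M + M - R) * s - (R + R) * t)) y≡ z≡ ⟩
  -- The factor `(1ℚ + R) * iR₁` is 1; it brings both terms over the denominator r + 1.
  iR * ((M + M - R) * (y * ((1ℚ + R) * iR₁)) - (R + R) * ((M * y - R * y) * iR₁))
    ≡⟨ solve 5 (λ iR M R y iR₁ →
         iR :* ((M :+ M :- R) :* (y :* ((con 1ℚ :+ R) :* iR₁)) :- (R :+ R) :* ((M :* y :- R :* y) :* iR₁)) :=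
         y :* ((M :+ M) :* (iR :* iR₁) :+ (R :* iR) :* (R :- con 1ℚ) :* iR₁)) refl iR M R y iR₁ ⟩
  y * ((M + M) * (iR * iR₁) + (R * iR) * (R - 1ℚ) * iR₁)
    ≡⟨ cong (λ s → y * ((M + M) * (iR * iR₁) + s * iR₁))
         (trans (cong (_* (R - 1ℚ)) (ι*inv≡1 (suc ρ))) (trans (*-identityˡ (R - 1ℚ)) R-1≡)) ⟩
  y * ((M + M) * (iR * iR₁) + ι ρ * iR₁) ∎
  where
  R = ι (suc ρ)
  M = ι m
  iR = inv (suc ρ)
  iR₁ = inv (suc (suc ρ))
  y = ι (m C suc ρ)
  z = ι (m C suc (suc ρ))
  one : (1ℚ + R) * iR₁ ≡ 1ℚ
  one = trans (cong (_* iR₁) (sym (ι-suc (suc ρ)))) (ι*inv≡1 (suc (suc ρ)))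
  R-1≡ : R - 1ℚ ≡ ι ρ
  R-1≡ = trans (cong (_- 1ℚ) (ι-suc ρ)) (solve 1 (λ K → con 1ℚ :+ K :- con 1ℚ := K) refl (ι ρ))
  y≡ : y ≡ y * ((1ℚ + R) * iR₁)
  y≡ = sym (trans (cong (y *_) one) (*-identityʳ y))
  z≡ : z ≡ (M * y - R * y) * iR₁
  z≡ = begin
    z                                             ≡⟨ trans (cong (z *_) one) (*-identityʳ z) ⟨
    z * ((1ℚ + R) * iR₁)                          ≡⟨ solve 4 (λ z R iR₁ y → z :* ((con 1ℚ :+ R) :* iR₁) :=
                                                       ((con 1ℚ :+ R) :* z :+ R :* y :- R :* y) :* iR₁) refl z R iR₁ y ⟩
    ((1ℚ + R) * z + R * y - R * y) * iR₁          ≡⟨ cong (λ s → (s * z + R * y - R * y) * iR₁) (ι-suc (suc ρ)) ⟨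
    (ι (suc (suc ρ)) * z + R * y - R * y) * iR₁   ≡⟨ cong (λ s → (s - R * y) * iR₁) (ι-absorb m (suc ρ)) ⟩
    (M * y - R * y) * iR₁                         ∎

ℙ-suc : ∀ ρ n .{{_ : NonZero n}} .{{_ : NonZero (n C suc ρ)}} → ∀ l m → suc n ≡ l ℕ.+ m → l ≤ m → (∀ i → i < m → i ℕ.+ i ≤ n) →
  ℙ[Z n ≡ suc ρ ] ≡ inv (suc n) * (scale ρ n * (Σ< l (weight ρ n) + Σ< m (weight ρ n)))
ℙ-suc ρ n l m 1+n≡ l≤m 2i≤n = trans (ℙ-formula n (suc ρ)) (cong (inv (suc n) *_) (Σ<-chance ρ n l m 1+n≡ l≤m 2i≤n))

ℙ-odd : ∀ ρ l → let n = suc (l ℕ.+ l) in .{{_ : NonZero (n C suc ρ)}} → ℙ[Z n ≡ suc ρ ] ≡ closedForm ρ n 0ℚ (suc l) l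
ℙ-odd ρ l = begin
  ℙ[Z n ≡ suc ρ ]
    ≡⟨ ℙ-suc ρ n (suc l) (suc l) (cong suc (sym (ℕ.+-suc l l))) ℕ.≤-refl
         (λ i i<m → ℕ.m≤n⇒m≤1+n (ℕ.+-mono-≤ (ℕ.s≤s⁻¹ i<m) (ℕ.s≤s⁻¹ i<m))) ⟩
  i * (p * (iR * iN) * (Σ< (suc l) (weight ρ n) + Σ< (suc l) (weight ρ n)))
    ≡⟨ cong (λ s → i * (p * (iR * iN) * (s + s))) (trans (Σ<-weight ρ n (suc l)) (cong (λ s → s * y - (R + R) * z) N-K≡)) ⟩
  i * (p * (iR * iN) * (S + S))
    ≡⟨ solve 5 (λ i p iR iN S → i :* (p :* (iR :* iN) :* (S :+ S)) := (p :+ p) :* i :* iN :* (iR :* S)) refl i p iR iN S ⟩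
  (p + p) * i * iN * (iR * S)
    ≡⟨ cong ((p + p) * i * iN *_) (inv-summed ρ (suc l)) ⟩
  (p + p) * i * iN * (y * ((M + M) * (iR * iR₁) + K * iR₁))
    -- Only the terms with the parity bracket, here 0, are added.
    ≡⟨ solve 9 (λ i p iR iN y M iR₁ K x → (p :+ p) :* i :* iN :* (y :* ((M :+ M) :* (iR :* iR₁) :+ K :* iR₁)) :=
         (p :+ p) :* i :* (y :* iN) :* ((M :+ M) :* (iR :* iR₁) :+ K :* iR₁ :+ con 0ℚ :* iR) :+
         con 0ℚ :* (p :* K :* (iR :* i)) :* (x :* iN)) refl i p iR iN y M iR₁ K (ι (l C ρ)) ⟩
  closedForm ρ n 0ℚ (suc l) l ∎
  where
  n = suc (l ℕ.+ l)
  i = inv (suc n)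
  p = ι (2 ^ ρ)
  iR = inv (suc ρ)
  iR₁ = inv (suc (suc ρ))
  iN = inv (n C suc ρ)
  K = ι ρ
  R = ι (suc ρ)
  M = ι (suc l)
  y = ι (suc l C suc ρ)
  z = ι (suc l C suc (suc ρ))
  S = (M + M - R) * y - (R + R) * z
  N-K≡ : ι n - K ≡ M + M - R
  N-K≡ = begin
    ι n - K                             ≡⟨ cong (_- K) (trans (ι-suc (l ℕ.+ l)) (cong (λ s → 1ℚ + s) (ι-+ l l))) ⟩
    1ℚ + (ι l + ι l) - K                ≡⟨ solve 2 (λ L K → con 1ℚ :+ (L :+ L) :- K :=
                                             (con 1ℚ :+ L) :+ (con 1ℚ :+ L) :- (con 1ℚ :+ K)) refl (ι l) K ⟩
    (1ℚ + ι l) + (1ℚ + ι l) - (1ℚ + K)  ≡⟨ cong₂ (λ s t → s + s - t) (ι-suc l) (ι-suc ρ) ⟨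
    M + M - R                           ∎

-- The two parity terms have separate origins. Since n - r + 1 is now 2m - r + 1, each half
-- contributes one more `y`, which gives the summand 1 / r in the parentheses. The start at height
-- 0, present only in the upper half, has weight `K * x`, which gives the final term with its factor
-- r - 1.
ℙ-even : ∀ ρ m → let n = m ℕ.+ m in .{{_ : NonZero n}} .{{_ : NonZero (n C suc ρ)}} → ℙ[Z n ≡ suc ρ ] ≡ closedForm ρ n 1ℚ m m
ℙ-even ρ m = begin
  ℙ[Z n ≡ suc ρ ]
    ≡⟨ ℙ-suc ρ n m (suc m) (sym (ℕ.+-suc m m)) (ℕ.n≤1+n m)
         (λ i i<m → ℕ.+-mono-≤ (ℕ.s≤s⁻¹ i<m) (ℕ.s≤s⁻¹ i<m)) ⟩
  i * (p * (iR * iN) * (Σ< m (weight ρ n) + (Σ< m (weight ρ n) + weight ρ n m)))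
    ≡⟨ cong₂ (λ s t → i * (p * (iR * iN) * (s + (s + t)))) (trans (Σ<-weight ρ n m) S≡) middle ⟩
  i * (p * (iR * iN) * ((S + y) + ((S + y) + K * x)))
    ≡⟨ solve 8 (λ i p iR iN S y K x → i :* (p :* (iR :* iN) :* ((S :+ y) :+ ((S :+ y) :+ K :* x))) :=
         (p :+ p) :* i :* iN :* (iR :* S) :+ (p :+ p) :* i :* iN :* (iR :* y) :+ p :* K :* (iR :* i) :* (x :* iN)) refl i p iR iN S y K x ⟩
  (p + p) * i * iN * (iR * S) + (p + p) * i * iN * (iR * y) + p * K * (iR * i) * (x * iN)
    ≡⟨ cong (λ s → (p + p) * i * iN * s + (p + p) * i * iN * (iR * y) + p * K * (iR * i) * (x * iN)) (inv-summed ρ m) ⟩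
  (p + p) * i * iN * (y * ((M + M) * (iR * iR₁) + K * iR₁)) + (p + p) * i * iN * (iR * y) + p * K * (iR * i) * (x * iN)
    ≡⟨ solve 9 (λ i p iR iN y M iR₁ K x →
         (p :+ p) :* i :* iN :* (y :* ((M :+ M) :* (iR :* iR₁) :+ K :* iR₁)) :+ (p :+ p) :* i :* iN :* (iR :* y) :+
           p :* K :* (iR :* i) :* (x :* iN) :=
         (p :+ p) :* i :* (y :* iN) :* ((M :+ M) :* (iR :* iR₁) :+ K :* iR₁ :+ con 1ℚ :* iR) :+
         con 1ℚ :* (p :* K :* (iR :* i)) :* (x :* iN)) refl i p iR iN y M iR₁ K x ⟩
  closedForm ρ n 1ℚ m m ∎
  where
  n = m ℕ.+ m
  i = inv (suc n)
  p = ι (2 ^ ρ)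
  iR = inv (suc ρ)
  iR₁ = inv (suc (suc ρ))
  iN = inv (n C suc ρ)
  K = ι ρ
  R = ι (suc ρ)
  M = ι m
  x = ι (m C ρ)
  y = ι (m C suc ρ)
  z = ι (m C suc (suc ρ))
  S = (M + M - R) * y - (R + R) * z
  S≡ : (ι n - K) * y - (R + R) * z ≡ S + y
  S≡ = begin
    (ι n - K) * y - (R + R) * z                       ≡⟨ cong (λ s → (s - K) * y - (R + R) * z) (ι-+ m m) ⟩
    (M + M - K) * y - (R + R) * z                     ≡⟨ solve 5 (λ M K R y z → (M :+ M :- K) :* y :- (R :+ R) :* z :=
                                                           (M :+ M :- (con 1ℚ :+ K)) :* y :- (R :+ R) :* z :+ y) refl M K R y z ⟩
    (M + M - (1ℚ + K)) * y - (R + R) * z + y          ≡⟨ cong (λ s → (M + M - s) * y - (R + R) * z + y) (ι-suc ρ) ⟨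
    S + y                                             ∎
  middle : weight ρ n m ≡ K * x
  middle = begin
    (ι n - M) * x - R * y        ≡⟨ cong (λ s → (s - M) * x - R * y) (ι-+ m m) ⟩
    (M + M - M) * x - R * y      ≡⟨ solve 4 (λ M x R y → (M :+ M :- M) :* x :- R :* y := M :* x :- R :* y) refl M x R y ⟩
    M * x - R * y                ≡⟨ cong (_- R * y) (ι-absorb m ρ) ⟨
    R * y + K * x - R * y        ≡⟨ solve 2 (λ a b → a :+ b :- a := b) refl (R * y) (K * x) ⟩
    K * x                        ∎

2∣n+n : ∀ n → 2 ∣ n ℕ.+ n
2∣n+n n = divides n (trans (cong (n ℕ.+_) (sym (ℕ.+-identityʳ n))) (ℕ.*-comm 2 n))

2∤1+n+n : ∀ n → ¬ 2 ∣ suc (n ℕ.+ n)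
2∤1+n+n n 2∣ with () ← ∣1⇒≡1 (∣m+n∣m⇒∣n (subst (2 ∣_) (ℕ.+-comm 1 (n ℕ.+ n)) 2∣) (2∣n+n n))

ℙ-positive : ∀ ρ n .{{_ : NonZero n}} .{{_ : NonZero (n C suc ρ)}} → ℙ[Z n ≡ suc ρ ] ≡
  (+ (2 ^ suc ρ) / suc n) * (+ (⌈ n /2⌉ C suc ρ) / (n C suc ρ))
    * ((+ (2 *ℕ ⌈ n /2⌉) / (suc ρ *ℕ suc (suc ρ))) + (+ ρ / suc (suc ρ)) + ⟦ 2 ∣? n ⟧ * (+ 1 / suc ρ))
  + ⟦ 2 ∣? n ⟧ * (+ (2 ^ ρ *ℕ ρ) / (suc ρ *ℕ suc n)) * (+ (⌊ n /2⌋ C ρ) / (n C suc ρ))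
ℙ-positive ρ n with even⊎odd n
... | inj₁ (m , refl) = trans (ℙ-even ρ m) (closedForm≡ ρ n
  (⟦yes⟧ (2 ∣? n) (2∣n+n m))
  (sym (ℕ.n≡⌈n+n/2⌉ m)) (sym (ℕ.n≡⌊n+n/2⌋ m)))
... | inj₂ (l , refl) = trans (ℙ-odd ρ l) (closedForm≡ ρ n (⟦no⟧ (2 ∣? n) (2∤1+n+n l))
  (cong suc (sym (ℕ.n≡⌊n+n/2⌋ l))) (sym (ℕ.n≡⌈n+n/2⌉ l)))

-- Impossible numbers of zeros, and the theorem.

visits≡0⇒ℙ≡0 : ∀ n r → (∀ a → visits n a r ≡ 0) → ℙ[Z n ≡ r ] ≡ 0ℚ
visits≡0⇒ℙ≡0 n r visits≡0 = begin
  ℙ[Z n ≡ r ]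
    ≡⟨ ℙ-formula n r ⟩
  inv (suc n) * Σ< (suc n) (chance n r)
    ≡⟨ cong (inv (suc n) *_) (Σ<-cong (suc n) (λ k _ →
         trans (cong (_* inv (n C k)) (trans (cong ι (visits≡0 ∣ startHeight n k ∣)) ι-0)) (*-zeroˡ (inv (n C k))))) ⟩
  inv (suc n) * Σ< (suc n) (λ _ → 0ℚ)
    ≡⟨ trans (cong (inv (suc n) *_) (Σ<-0 (suc n))) (*-zeroʳ (inv (suc n))) ⟩
  0ℚ ∎

theoremE1 : (∀ (r n : ℕ) .{{_ : NonZero r}} (n≥1 : n ≥ 1) (n≥2r-2 : n ≥ 2 *ℕ r ∸ 2) →
    let instance _ = nCr≢0 n r n≥1 n≥2r-2 in
    ℙ[Z n ≡ r ] ≡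
    (+ (2 ^ r) / suc n) * (+ (⌈ n /2⌉ C r) / (n C r))
    * ((+ (2 *ℕ ⌈ n /2⌉) / (r *ℕ suc r)) + (+ (r ∸ 1) / suc r) + ⟦ 2 ∣? n ⟧ * (+ 1 / r))
    + ⟦ 2 ∣? n ⟧ * (+ (2 ^ (r ∸ 1) *ℕ (r ∸ 1)) / (r *ℕ suc n)) * (+ (⌊ n /2⌋ C (r ∸ 1)) / (n C r)))
    × (∀ (r : ℕ) → ℙ[Z 0 ≡ r ] ≡ ⟦ r ≟ 1 ⟧)
    × (∀ (r n : ℕ) → n ≥ 1 → (n < 2 *ℕ r ∸ 2 ⊎ r ≡ 0) → ℙ[Z n ≡ r ] ≡ 0ℚ)
theoremE1 = positive , empty , impossible
  where
  positive : ∀ (r n : ℕ) .{{_ : NonZero r}} (n≥1 : n ≥ 1) (n≥2r-2 : n ≥ 2 *ℕ r ∸ 2) →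
    let instance _ = nCr≢0 n r n≥1 n≥2r-2 in
    ℙ[Z n ≡ r ] ≡
    (+ (2 ^ r) / suc n) * (+ (⌈ n /2⌉ C r) / (n C r))
    * ((+ (2 *ℕ ⌈ n /2⌉) / (r *ℕ suc r)) + (+ (r ∸ 1) / suc r) + ⟦ 2 ∣? n ⟧ * (+ 1 / r))
    + ⟦ 2 ∣? n ⟧ * (+ (2 ^ (r ∸ 1) *ℕ (r ∸ 1)) / (r *ℕ suc n)) * (+ (⌊ n /2⌋ C (r ∸ 1)) / (n C r))
  positive (suc ρ) n n≥1 n≥2r-2 = ℙ-positive ρ n {{ℕ.>-nonZero n≥1}} {{nCr≢0 n (suc ρ) n≥1 n≥2r-2}}

  empty : ∀ r → ℙ[Z 0 ≡ r ] ≡ ⟦ r ≟ 1 ⟧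
  -- For length 0 there is one path and it has one zero; splitting `r` around 1 lets both sides
  -- compute.
  empty zero          = refl
  empty (suc zero)    = refl
  empty (suc (suc r)) = refl

  impossible : ∀ r n → n ≥ 1 → (n < 2 *ℕ r ∸ 2 ⊎ r ≡ 0) → ℙ[Z n ≡ r ] ≡ 0ℚ
  impossible r n _ (inj₂ refl)   = visits≡0⇒ℙ≡0 n 0 (visits-0 n)
  impossible r n _ (inj₁ n<2r-2) = visits≡0⇒ℙ≡0 n r (λ a → n+2<a+2r⇒visits≡0 n a r
    -- Undoing the truncated subtraction: 2r ≤ n + 2 would give 2r ∸ 2 ≤ n, so n + 2 < 2r, and
    -- adding `a` keeps the bound.
    (ℕ.<-≤-trans (ℕ.≰⇒> (λ 2r≤n+2 → ℕ.<⇒≱ n<2r-2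
      (ℕ.m≤n+o⇒m∸n≤o (2 *ℕ r) 2 (subst (2 *ℕ r ≤_) (ℕ.+-comm n 2) 2r≤n+2)))) (ℕ.m≤n+m (2 *ℕ r) a)))
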